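{- Suppose $\alpha,\beta$ are rational numbers with $0 < \alpha + 1 < \beta$. Then $$\mathrm{SC}\bigl(\lambda n.\, n/(\log_2 n)^\beta\bigr) \leq_{\mathrm{s}} \mathrm{COMPLEX}\bigl(\lambda n.\, n/(\log_2 n)^\alpha\bigr).$$
   Context: Prefix-free complexity: a prefix-free machine is a partial recursive $M$ from $\{0,1\}^*$ to $\{0,1\}^*$ with prefix-free domain; $U$ is universal if for each prefix-free machine $M$ there is $\rho$ with $U(\rho^\frown\tau)\simeq M(\tau)$ for all $\tau$. Fix a universal $U$ and let $K(\sigma)=\min\{|\tau| : U(\tau)=\sigma\}$. For $f\colon\mathbb{N}\to\mathbb{R}$, $\mathrm{COMPLEX}(f)$ is the set of $X\in\{0,1\}^{\mathbb{N}}$ for which there is $c\in\mathbb{N}$ with $K(X\upharpoonright n)\geq f(n)-c$ for all $n$; $\mathrm{SC}(f)$ is the set of $X\in\{0,1\}^{\mathbb{N}}$ for which there is $c\in\mathbb{N}$ with $K(\tau)\geq f(|\tau|)-c$ for every (contiguous, finite) substring $\tau$ of $X$. In both definitions, because of the constant $c$, finitely many values of $f$ are irrelevant; if $f$ is only suitable (defined and nondecreasing) for $n\geq a$, its values for $n<a$ are set to $f(a)$. For $P,Q\subseteq\mathbb{N}^{\mathbb{N}}$, $P\leq_{\mathrm{s}}Q$ means there is a partial recursive functional defined on all of $Q$ that maps $Q$ into $P$. -}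

module Defs where

import Algebra.Definitions.RawSemiring as RawExp
open import Data.Bool.Base using (Bool; true; false)
open import Data.Empty using (⊥; ⊥-elim)
open import Data.Fin.Base using (Fin)
open import Data.Integer.Base as Int using (ℤ; +_; -[1+_])
import Data.Integer.Properties as Intₚ
open import Data.List.Base using (List; []; _∷_; _++_; length; applyUpTo)
open import Data.List.Relation.Binary.Prefix.Heterogeneous using (Prefix)
open import Data.Nat.Base as Nat using (ℕ; zero; suc; NonTrivial)
import Data.Nat.Coprimality as Coprimality
import Data.Nat.Properties as Natₚ
open import Data.Product.Base using (∃; ∃₂; ∃-syntax; Σ-syntax; _×_; _,_; proj₁; proj₂)
open import Data.Rational.Base using (ℚ; mkℚ; 0ℚ; 1ℚ; ½; ↥_; ↧_; ↧ₙ_; 1/_; *<*; *≤*; _<_; _≤_; _*_; _+_; -_; _/_; +-*-rawSemiring)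
import Data.Rational.Base as Rat
import Data.Rational.Properties as Ratₚ
open import Data.Sum.Base using (_⊎_; inj₁; inj₂)
open import Data.Vec.Base using (Vec; []; _∷_; lookup)
open import Data.Vec.Relation.Binary.Pointwise.Inductive using (Pointwise)
open import Function.Bundles using (_⇔_)
open import Level using (0ℓ)
open import Relation.Binary.PropositionalEquality
open import Relation.Nullary using (¬_; yes; no)
open import Relation.Unary using (Pred)

-- Kleene's μ-recursive functions of n arguments, relative to k oracles.
-- k = 0 gives the partial recursive functions, k = 1 the partial
-- recursive functionals.
data PartialRecursive (k : ℕ) : ℕ → Set where
  zeroᶠ   : PartialRecursive k 0
  sucᶠ    : PartialRecursive k 1
  proj    : ∀ {n} → Fin n → PartialRecursive k n
  oracle  : Fin k → PartialRecursive k 1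
  compose : ∀ {m n} → PartialRecursive k m → Vec (PartialRecursive k n) m → PartialRecursive k n
  primrec : ∀ {n} → PartialRecursive k n → PartialRecursive k (2 Nat.+ n) → PartialRecursive k (1 Nat.+ n)
  mu      : ∀ {n} → PartialRecursive k (1 Nat.+ n) → PartialRecursive k n

infix 4 _⊢_[_]↓_

-- F ⊢ f [ xs ]↓ y : with oracles F, f converges on xs with value y.
data _⊢_[_]↓_ {k : ℕ} (F : Fin k → ℕ → ℕ) :
              ∀ {n} → PartialRecursive k n → Vec ℕ n → ℕ → Set where
  zero↓    : F ⊢ zeroᶠ [ [] ]↓ 0
  suc↓     : ∀ {x} → F ⊢ sucᶠ [ x ∷ [] ]↓ suc x
  proj↓    : ∀ {n} {i : Fin n} {xs} → F ⊢ proj i [ xs ]↓ lookup xs i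
  oracle↓  : ∀ {i x} → F ⊢ oracle i [ x ∷ [] ]↓ F i x
  compose↓ : ∀ {m n} {f : PartialRecursive k m} {gs : Vec (PartialRecursive k n) m} {xs ys z} →
             Pointwise (λ g y → F ⊢ g [ xs ]↓ y) gs ys →
             F ⊢ f [ ys ]↓ z →
             F ⊢ compose f gs [ xs ]↓ z
  base↓    : ∀ {n} {f : PartialRecursive k n} {g xs y} →
             F ⊢ f [ xs ]↓ y →
             F ⊢ primrec f g [ 0 ∷ xs ]↓ y
  step↓    : ∀ {n} {f : PartialRecursive k n} {g x xs y z} →
             F ⊢ primrec f g [ x ∷ xs ]↓ y →
             F ⊢ g [ x ∷ y ∷ xs ]↓ z →
             F ⊢ primrec f g [ suc x ∷ xs ]↓ z
  mu↓      : ∀ {n} {f : PartialRecursive k (1 Nat.+ n)} {xs y} →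
             (∀ x → x Nat.< y → ∃[ z ] F ⊢ f [ x ∷ xs ]↓ suc z) →
             F ⊢ f [ y ∷ xs ]↓ 0 →
             F ⊢ mu f [ xs ]↓ y

MassProblem : Set₁
MassProblem = Pred (ℕ → ℕ) 0ℓ

infix 4 _≤ₛ_

_≤ₛ_ : MassProblem → MassProblem → Set
P ≤ₛ Q = Σ[ Φ ∈ PartialRecursive 1 1 ]
  (∀ X → Q X → Σ[ Y ∈ (ℕ → ℕ) ] ((∀ n → (λ _ → X) ⊢ Φ [ n ∷ [] ]↓ Y n) × P Y))

bit : Bool → ℕ
bit false = 0
bit true  = 1

-- A set of binary sequences, regarded as a subset of ℕ^ℕ.
binary : Pred (ℕ → Bool) 0ℓ → MassProblem
binary P Y = Σ[ X ∈ (ℕ → Bool) ] ((∀ n → Y n ≡ bit (X n)) × P X)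

String : Set
String = List Bool

-- Bijective base-2 numeration: a bijection between strings and ℕ.
code : String → ℕ
code []          = 0
code (false ∷ σ) = 1 Nat.+ 2 Nat.* code σ
code (true  ∷ σ) = 2 Nat.+ 2 Nat.* code σ

-- Strings are passed to and returned by a machine through code.
Machine : Set
Machine = PartialRecursive 0 1

infix 4 _⟨_⟩≃_

_⟨_⟩≃_ : Machine → String → String → Set
M ⟨ τ ⟩≃ σ = (λ ()) ⊢ M [ code τ ∷ [] ]↓ code σ

_∈dom_ : String → Machine → Set
τ ∈dom M = ∃[ σ ] M ⟨ τ ⟩≃ σ

PrefixFree : Machine → Set
PrefixFree M = ∀ τ τ′ → τ ∈dom M → τ′ ∈dom M → Prefix _≡_ τ τ′ → τ ≡ τ′

record Universal (U : Machine) : Set where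
  field
    prefixFree : PrefixFree U
    simulates  : ∀ M → PrefixFree M →
                 ∃[ ρ ] (∀ τ σ → (U ⟨ ρ ++ τ ⟩≃ σ) ⇔ (M ⟨ τ ⟩≃ σ))

-- IsK U σ k : K(σ) = k.  A relation, because K is not computable.
IsK : Machine → String → ℕ → Set
IsK U σ k = (∃[ τ ] (length τ ≡ k × (U ⟨ τ ⟩≃ σ)))
          × (∀ τ → U ⟨ τ ⟩≃ σ → k Nat.≤ length τ)

open RawExp +-*-rawSemiring using () renaming (_^_ to _^ℚ_) public

fromℕ : ℕ → ℚ
fromℕ n = mkℚ (+ n) 0 (Coprimality.sym (Coprimality.1-coprimeTo n))

module RationalLemmas where

  abstract

    0<1 : 0ℚ < 1ℚ
    0<1 = *<* (Int.+<+ (Nat.s≤s Nat.z≤n))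

    1<⇒0< : ∀ {a} → 1ℚ < a → 0ℚ < a
    1<⇒0< = Ratₚ.<-trans 0<1

    *-monoˡ : ∀ {a b c} → 0ℚ ≤ a → b ≤ c → a * b ≤ a * c
    *-monoˡ {a} 0≤a b≤c = Ratₚ.*-monoˡ-≤-nonNeg a {{Rat.nonNegative 0≤a}} b≤c

    *-monoʳ : ∀ {a b c} → 0ℚ ≤ a → b ≤ c → b * a ≤ c * a
    *-monoʳ {a} 0≤a b≤c = Ratₚ.*-monoʳ-≤-nonNeg a {{Rat.nonNegative 0≤a}} b≤c

    *-mono : ∀ {a b c d} → 0ℚ ≤ c → 0ℚ ≤ b → a ≤ b → c ≤ d → a * c ≤ b * d
    *-mono 0≤c 0≤b a≤b c≤d = Ratₚ.≤-trans (*-monoʳ 0≤c a≤b) (*-monoˡ 0≤b c≤d)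

    *-mono-<ˡ : ∀ {a b c} → 0ℚ < a → b < c → a * b < a * c
    *-mono-<ˡ {a} 0<a b<c = Ratₚ.*-monoʳ-<-pos a {{Rat.positive 0<a}} b<c

    *-mono-<ʳ : ∀ {a b c} → 0ℚ < a → b < c → b * a < c * a
    *-mono-<ʳ {a} 0<a b<c = Ratₚ.*-monoˡ-<-pos a {{Rat.positive 0<a}} b<c

    *-pos : ∀ {a b} → 0ℚ < a → 0ℚ < b → 0ℚ < a * b
    *-pos {a} {b} 0<a 0<b = subst (_< a * b) (Ratₚ.*-zeroʳ a) (*-mono-<ˡ 0<a 0<b)

    ^-pos : ∀ {a} n → 0ℚ < a → 0ℚ < a ^ℚ n
    ^-pos zero    0<a = 0<1
    ^-pos (suc n) 0<a = *-pos 0<a (^-pos n 0<a)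

    ^-mono : ∀ {a b} n → 0ℚ < a → a ≤ b → a ^ℚ n ≤ b ^ℚ n
    ^-mono zero    0<a a≤b = Ratₚ.≤-refl
    ^-mono (suc n) 0<a a≤b =
      *-mono (Ratₚ.<⇒≤ (^-pos n 0<a)) (Ratₚ.<⇒≤ (Ratₚ.<-≤-trans 0<a a≤b)) a≤b (^-mono n 0<a a≤b)

    ^-mono-< : ∀ {a b} n .{{_ : Nat.NonZero n}} → 0ℚ < a → a < b → a ^ℚ n < b ^ℚ n
    ^-mono-< (suc n) 0<a a<b =
      Ratₚ.<-≤-trans (*-mono-<ʳ (^-pos n 0<a) a<b)
                     (*-monoˡ (Ratₚ.<⇒≤ (Ratₚ.<-trans 0<a a<b)) (^-mono n 0<a (Ratₚ.<⇒≤ a<b)))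

    1^n : ∀ n → 1ℚ ^ℚ n ≡ 1ℚ
    1^n zero    = refl
    1^n (suc n) = trans (Ratₚ.*-identityˡ _) (1^n n)

    1≤^ : ∀ {a} n → 1ℚ ≤ a → 1ℚ ≤ a ^ℚ n
    1≤^ {a} n 1≤a = subst (_≤ a ^ℚ n) (1^n n) (^-mono n 0<1 1≤a)

    ≤^ : ∀ {a} n .{{_ : Nat.NonZero n}} → 1ℚ ≤ a → a ≤ a ^ℚ n
    ≤^ {a} (suc n) 1≤a = subst (_≤ a ^ℚ suc n) (Ratₚ.*-identityʳ a)
      (*-monoˡ (Ratₚ.≤-trans (Ratₚ.<⇒≤ 0<1) 1≤a) (1≤^ n 1≤a))

    ^≤ : ∀ {a} n .{{_ : Nat.NonZero n}} → 0ℚ < a → a ≤ 1ℚ → a ^ℚ n ≤ a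
    ^≤ {a} (suc n) 0<a a≤1 = subst (a ^ℚ suc n ≤_) (Ratₚ.*-identityʳ a)
      (*-monoˡ (Ratₚ.<⇒≤ 0<a) (subst (a ^ℚ n ≤_) (1^n n) (^-mono n 0<a a≤1)))

    *-^ : ∀ a b n → (a * b) ^ℚ n ≡ a ^ℚ n * b ^ℚ n
    *-^ a b zero    = refl
    *-^ a b (suc n) = begin
        (a * b) * (a * b) ^ℚ n         ≡⟨ cong ((a * b) *_) (*-^ a b n) ⟩
        (a * b) * (a ^ℚ n * b ^ℚ n)    ≡⟨ Ratₚ.*-assoc a b (a ^ℚ n * b ^ℚ n) ⟩
        a * (b * (a ^ℚ n * b ^ℚ n))    ≡⟨ cong (a *_) (Ratₚ.*-assoc b (a ^ℚ n) (b ^ℚ n)) ⟨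
        a * ((b * a ^ℚ n) * b ^ℚ n)    ≡⟨ cong (λ z → a * (z * b ^ℚ n)) (Ratₚ.*-comm b (a ^ℚ n)) ⟩
        a * ((a ^ℚ n * b) * b ^ℚ n)    ≡⟨ cong (a *_) (Ratₚ.*-assoc (a ^ℚ n) b (b ^ℚ n)) ⟩
        a * (a ^ℚ n * (b * b ^ℚ n))    ≡⟨ Ratₚ.*-assoc a (a ^ℚ n) (b * b ^ℚ n) ⟨
        (a * a ^ℚ n) * (b * b ^ℚ n)    ∎
      where open ≡-Reasoning

    *-cancelˡ-< : ∀ {a b c} → 0ℚ < a → a * b < a * c → b < c
    *-cancelˡ-< {a} 0<a = Ratₚ.*-cancelˡ-<-nonNeg a {{Rat.nonNegative (Ratₚ.<⇒≤ 0<a)}}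

    divide : ∀ {a} → 0ℚ < a → ∀ b → ∃[ v ] a * v ≡ b
    divide {a} 0<a b = (1/ a) * b , (begin
        a * ((1/ a) * b)  ≡⟨ Ratₚ.*-assoc a (1/ a) b ⟨
        (a * (1/ a)) * b  ≡⟨ cong (_* b) (Ratₚ.*-inverseʳ a) ⟩
        1ℚ * b            ≡⟨ Ratₚ.*-identityˡ b ⟩
        b                 ∎)
      where
      open ≡-Reasoning
      instance
        a≢0 : Rat.NonZero a
        a≢0 = Rat.>-nonZero 0<a

    divide⁺ : ∀ {a b} → 0ℚ < a → 0ℚ < b → ∃[ v ] (0ℚ < v × a * v ≡ b)
    divide⁺ {a} {b} 0<a 0<b with divide 0<a b
    ... | v , av≡b = v , *-cancelˡ-< 0<a (subst₂ _<_ (sym (Ratₚ.*-zeroʳ a)) (sym av≡b) 0<b) , av≡b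

    ratio : ∀ {a b} → 0ℚ < a → a < b → ∃[ v ] (1ℚ < v × a * v ≡ b)
    ratio {a} {b} 0<a a<b with divide 0<a b
    ... | v , av≡b = v , *-cancelˡ-< 0<a (subst₂ _<_ (sym (Ratₚ.*-identityʳ a)) (sym av≡b) a<b) , av≡b

    <-+ : ∀ {a δ} → 0ℚ < δ → a < a + δ
    <-+ {a} {δ} 0<δ = subst (_< a + δ) (Ratₚ.+-identityʳ a) (Ratₚ.+-monoʳ-< a 0<δ)

    √below : ∀ {q} → 1ℚ < q → ∃[ m ] (1ℚ < m × m * m ≤ q)
    √below {q} 1<q = let m , 1<m , m<q = Ratₚ.<-dense 1<q
                         h , 1<h , mh≡q = ratio (1<⇒0< 1<m) m<q
                     in pick m h 1<m 1<h mh≡q (Ratₚ.≤-total m h)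
      where
      pick : ∀ m h → 1ℚ < m → 1ℚ < h → m * h ≡ q → m ≤ h ⊎ h ≤ m → ∃[ m ] (1ℚ < m × m * m ≤ q)
      pick m h 1<m 1<h mh≡q (inj₁ m≤h) =
        m , 1<m , subst (m * m ≤_) mh≡q (*-monoˡ (Ratₚ.<⇒≤ (1<⇒0< 1<m)) m≤h)
      pick m h 1<m 1<h mh≡q (inj₂ h≤m) =
        h , 1<h , subst (h * h ≤_) mh≡q (*-monoʳ (Ratₚ.<⇒≤ (1<⇒0< 1<h)) h≤m)

    rootBelow : ∀ n {q} → 1ℚ < q → ∃[ k ] (1ℚ < k × k ^ℚ n ≤ q)
    rootBelow zero    {q} 1<q = q , 1<q , Ratₚ.<⇒≤ 1<q
    rootBelow (suc n) {q} 1<q = let m , 1<m , m*m≤q = √below 1<q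
                                    j , 1<j , j^n≤m = rootBelow n 1<m
                                in pick m j 1<m 1<j m*m≤q j^n≤m (Ratₚ.≤-total m j)
      where
      pick : ∀ m j → 1ℚ < m → 1ℚ < j → m * m ≤ q → j ^ℚ n ≤ m → m ≤ j ⊎ j ≤ m →
             ∃[ k ] (1ℚ < k × k ^ℚ suc n ≤ q)
      pick m j 1<m 1<j m*m≤q j^n≤m (inj₁ m≤j) = m , 1<m , Ratₚ.≤-trans
        (*-monoˡ (Ratₚ.<⇒≤ (1<⇒0< 1<m)) (Ratₚ.≤-trans (^-mono n (1<⇒0< 1<m) m≤j) j^n≤m)) m*m≤q
      pick m j 1<m 1<j m*m≤q j^n≤m (inj₂ j≤m) = j , 1<j , Ratₚ.≤-trans
        (*-mono (Ratₚ.<⇒≤ (^-pos n (1<⇒0< 1<j))) (Ratₚ.<⇒≤ (1<⇒0< 1<m)) j≤m j^n≤m) m*m≤q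

    fromℕ≡n/1 : ∀ n → fromℕ n ≡ + n / 1
    fromℕ≡n/1 n = sym (Ratₚ.normalize-coprime (Coprimality.sym (Coprimality.1-coprimeTo n)))

    fromℕ-suc : ∀ n → fromℕ (suc n) ≡ 1ℚ + fromℕ n
    fromℕ-suc n = trans (fromℕ≡n/1 (suc n))
      (cong (λ i → (Int.1ℤ Int.+ i) / 1) (sym (Intₚ.*-identityʳ (+ n))))

    fromℕ-pos : ∀ n .{{_ : Nat.NonZero n}} → 0ℚ < fromℕ n
    fromℕ-pos (suc n) = Ratₚ.positive⁻¹ (fromℕ (suc n))

    archimedean : ∀ q → ∃[ n ] q ≤ fromℕ n
    archimedean q@(mkℚ (+ n) d _) = n ,
      *≤* (Intₚ.*-monoˡ-≤-nonNeg (+ n) (Int.+≤+ (Nat.s≤s Nat.z≤n)))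
    archimedean q@(mkℚ -[1+ n ] d _) = 0 , Ratₚ.<⇒≤ (Ratₚ.negative⁻¹ q)

    halve : ∀ {k} → 1ℚ < k → ∃[ ε ] (0ℚ < ε × 1ℚ + (ε + ε) ≡ k)
    halve {k} 1<k = ½ * d , *-pos {½} {d} (*<* (Int.+<+ (Nat.s≤s Nat.z≤n)))
        (subst (_< d) (Ratₚ.+-inverseʳ 1ℚ) (Ratₚ.+-monoˡ-< (- 1ℚ) 1<k)) ,
      (begin
        1ℚ + (½ * d + ½ * d)  ≡⟨ cong (λ z → 1ℚ + z) (Ratₚ.*-distribʳ-+ d ½ ½) ⟨
        1ℚ + 1ℚ * d           ≡⟨ cong (λ z → 1ℚ + z) (Ratₚ.*-identityˡ d) ⟩
        1ℚ + (k + - 1ℚ)       ≡⟨ cong (λ z → 1ℚ + z) (Ratₚ.+-comm k (- 1ℚ)) ⟩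
        1ℚ + (- 1ℚ + k)       ≡⟨ Ratₚ.+-assoc 1ℚ (- 1ℚ) k ⟨
        0ℚ + k                ≡⟨ Ratₚ.+-identityˡ k ⟩
        k                     ∎)
      where
      open ≡-Reasoning
      d : ℚ
      d = k + - 1ℚ

open RationalLemmas

-- Dedekind cuts.
record ℝ : Set₁ where
  field
    lower upper     : ℚ → Set
    lower-inhabited : ∃[ q ] lower q
    upper-inhabited : ∃[ q ] upper q
    lower-closed    : ∀ {q r} → q < r → lower r → lower q
    upper-closed    : ∀ {q r} → q < r → upper q → upper r
    lower-open      : ∀ {q} → lower q → ∃[ r ] (q < r × lower r)
    upper-open      : ∀ {r} → upper r → ∃[ q ] (q < r × upper q)
    disjoint        : ∀ {q} → lower q → ¬ upper q
    located         : ∀ {q r} → q < r → lower q ⊎ upper r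

  lower<upper : ∀ {q r} → lower q → upper r → q < r
  lower<upper {q} {r} lq ur with q Ratₚ.<? r
  ... | yes q<r = q<r
  ... | no  q≮r with Ratₚ.≮⇒≥ q≮r
  ... | r≤q with r Ratₚ.<? q
  ... | yes r<q = ⊥-elim (disjoint lq (upper-closed r<q ur))
  ... | no  r≮q = ⊥-elim (disjoint lq (subst upper (Ratₚ.≤-antisym r≤q (Ratₚ.≮⇒≥ r≮q)) ur))

infix 4 _≤ᴿ_

_≤ᴿ_ : ℝ → ℝ → Set
x ≤ᴿ y = ∀ q → ℝ.lower x q → ℝ.lower y q

fromℚ : ℚ → ℝ
fromℚ p = record
  { lower           = _< p
  ; upper           = p <_
  ; lower-inhabited = p + - 1ℚ , subst (p + - 1ℚ <_) (Ratₚ.+-identityʳ p)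
                        (Ratₚ.+-monoʳ-< p (*<* Int.-<+))
  ; upper-inhabited = p + 1ℚ , <-+ 0<1
  ; lower-closed    = Ratₚ.<-trans
  ; upper-closed    = λ q<r p<q → Ratₚ.<-trans p<q q<r
  ; lower-open      = λ q<p → let m , q<m , m<p = Ratₚ.<-dense q<p in m , q<m , m<p
  ; upper-open      = λ p<r → let m , p<m , m<r = Ratₚ.<-dense p<r in m , m<r , p<m
  ; disjoint        = Ratₚ.<-asym
  ; located         = located
  }
  where
  located : ∀ {q r} → q < r → q < p ⊎ p < r
  located {q} q<r with q Ratₚ.<? p
  ... | yes q<p = inj₁ q<p
  ... | no  q≮p = inj₂ (Ratₚ.≤-<-trans (Ratₚ.≮⇒≥ q≮p) q<r)

ℝ⁺ : Set₁
ℝ⁺ = Σ[ x ∈ ℝ ] ℝ.lower x 0ℚ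

-- Below, lower and upper cuts are given as
--   { q | q < r for some r ∈ A }  and  { q | r < q for some r ∈ B }
-- with sets A and B of non-strict rational bounds.

-- log₂ n : a/b ≤ log₂ n iff 2ᵃ ≤ nᵇ.
log₂ : (n : ℕ) → .{{NonTrivial n}} → ℝ⁺
log₂ n = record
  { lower           = λ q → ∃[ r ] (q < r × 0ℚ ≤ r × 2 Nat.^ Int.∣ ↥ r ∣ Nat.≤ n Nat.^ ↧ₙ r)
  ; upper           = λ q → ∃[ r ] (r < q × 0ℚ ≤ r × n Nat.^ ↧ₙ r Nat.≤ 2 Nat.^ Int.∣ ↥ r ∣)
  ; lower-inhabited = 0ℚ , lower-0
  ; upper-inhabited = fromℕ n + 1ℚ , fromℕ n , <-+ 0<1 , fromℕ-nonNeg n ,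
                      subst (Nat._≤ 2 Nat.^ n) (sym (Natₚ.^-identityʳ n)) (n≤2^n n)
  ; lower-closed    = λ { q<r (s , r<s , rest) → s , Ratₚ.<-trans q<r r<s , rest }
  ; upper-closed    = λ { q<r (s , s<q , rest) → s , Ratₚ.<-trans s<q q<r , rest }
  ; lower-open      = λ { (s , q<s , rest) →
                        let m , q<m , m<s = Ratₚ.<-dense q<s in m , q<m , s , m<s , rest }
  ; upper-open      = λ { (s , s<q , rest) →
                        let m , s<m , m<q = Ratₚ.<-dense s<q in m , m<q , s , s<m , rest }
  ; disjoint        = λ { (r , q<r , 0≤r , lr) (s , s<q , 0≤s , us) →
                        disjoint r s 0≤r 0≤s (Ratₚ.<-trans s<q q<r) lr us }
  ; located         = located
  } , lower-0
  where
  fromℕ-nonNeg : ∀ k → 0ℚ ≤ fromℕ k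
  fromℕ-nonNeg k = Ratₚ.nonNegative⁻¹ (fromℕ k)

  1<n = Nat.nonTrivial⇒n>1 n

  instance
    n≢0 : Nat.NonZero n
    n≢0 = Nat.nonTrivial⇒nonZero n

  lower-0 : ∃[ r ] (0ℚ < r × 0ℚ ≤ r × 2 Nat.^ Int.∣ ↥ r ∣ Nat.≤ n Nat.^ ↧ₙ r)
  lower-0 = 1ℚ , 0<1 , Ratₚ.<⇒≤ 0<1 , Natₚ.^-monoˡ-≤ 1 1<n

  n≤2^n : ∀ k → k Nat.≤ 2 Nat.^ k
  n≤2^n zero    = Nat.z≤n
  n≤2^n (suc k) = Natₚ.+-mono-≤ (Natₚ.m^n>0 2 k) (Natₚ.≤-trans (n≤2^n k) (Natₚ.m≤m+n _ 0))

  disjoint : ∀ r s → 0ℚ ≤ r → 0ℚ ≤ s → s < r → 2 Nat.^ Int.∣ ↥ r ∣ Nat.≤ n Nat.^ ↧ₙ r →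
             ¬ (n Nat.^ ↧ₙ s Nat.≤ 2 Nat.^ Int.∣ ↥ s ∣)
  disjoint (mkℚ -[1+ _ ] _ _) s (*≤* ()) _ _ _ _
  disjoint (mkℚ (+ a) b _) (mkℚ -[1+ _ ] _ _) _ (*≤* ()) _ _ _
  disjoint (mkℚ (+ a) b′ _) (mkℚ (+ c) d′ _) _ _ (*<* cb<ad) 2^a≤n^b n^d≤2^c =
    Natₚ.<-irrefl refl (Natₚ.<-≤-trans cb<ad′ ad≤cb)
    where
    b = suc b′
    d = suc d′
    cb<ad′ : c Nat.* b Nat.< a Nat.* d
    cb<ad′ = Intₚ.drop‿+<+ (subst₂ Int._<_ (sym (Intₚ.pos-* c b)) (sym (Intₚ.pos-* a d)) cb<ad)
    ad≤cb : a Nat.* d Nat.≤ c Nat.* b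
    ad≤cb = Natₚ.≮⇒≥ λ cb<ad → Natₚ.<-irrefl refl (Natₚ.<-≤-trans
      (Natₚ.^-monoʳ-< 2 (Nat.s≤s (Nat.s≤s Nat.z≤n)) cb<ad) (begin
        2 Nat.^ (a Nat.* d)    ≡⟨ Natₚ.^-*-assoc 2 a d ⟨
        (2 Nat.^ a) Nat.^ d    ≤⟨ Natₚ.^-monoˡ-≤ d 2^a≤n^b ⟩
        (n Nat.^ b) Nat.^ d    ≡⟨ Natₚ.^-*-assoc n b d ⟩
        n Nat.^ (b Nat.* d)    ≡⟨ cong (n Nat.^_) (Natₚ.*-comm b d) ⟩
        n Nat.^ (d Nat.* b)    ≡⟨ Natₚ.^-*-assoc n d b ⟨
        (n Nat.^ d) Nat.^ b    ≤⟨ Natₚ.^-monoˡ-≤ b n^d≤2^c ⟩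
        (2 Nat.^ c) Nat.^ b    ≡⟨ Natₚ.^-*-assoc 2 c b ⟩
        2 Nat.^ (c Nat.* b)    ∎))
      where open Natₚ.≤-Reasoning

  located : ∀ {q r} → q < r →
            (∃[ s ] (q < s × 0ℚ ≤ s × 2 Nat.^ Int.∣ ↥ s ∣ Nat.≤ n Nat.^ ↧ₙ s)) ⊎
            (∃[ s ] (s < r × 0ℚ ≤ s × n Nat.^ ↧ₙ s Nat.≤ 2 Nat.^ Int.∣ ↥ s ∣))
  located {q} {r} q<r with Ratₚ.<-dense q<r
  ... | m , q<m , m<r with 0ℚ Ratₚ.≤? m
  ... | no  0≰m = inj₁ (1ℚ , Ratₚ.<-trans q<m (Ratₚ.<-trans (Ratₚ.≰⇒> 0≰m) 0<1) ,
                        proj₂ (proj₂ lower-0))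
  ... | yes 0≤m with Natₚ.≤-total (2 Nat.^ Int.∣ ↥ m ∣) (n Nat.^ ↧ₙ m)
  ... | inj₁ le = inj₁ (m , q<m , 0≤m , le)
  ... | inj₂ ge = inj₂ (m , m<r , 0≤m , ge)

module _ (x : ℝ) (x-pos : ℝ.lower x 0ℚ) where

  open ℝ x

  abstract

    upper-pos : ∀ {t} → upper t → 0ℚ < t
    upper-pos = lower<upper x-pos

    -- Starting from s > 0 below x, walk up in steps of δ until just past x.
    walk : ∀ {s δ ε k} → 0ℚ < s → 0ℚ < δ → 0ℚ < ε → δ ≡ s * ε → 1ℚ + (ε + ε) ≡ k →
           ∀ n a → s ≤ a → lower a → ∀ {u} → upper u → u ≤ a + fromℕ n * δ →
           ∃₂ λ s t → 0ℚ < s × lower s × upper t × t ≤ s * k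
    walk {s} {δ} 0<s 0<δ 0<ε δ≡ k≡ zero a s≤a la {u} uu u≤a =
      ⊥-elim (Ratₚ.<-irrefl refl (Ratₚ.<-≤-trans (lower<upper la uu)
        (subst (u ≤_) (trans (cong (λ z → a + z) (Ratₚ.*-zeroˡ δ)) (Ratₚ.+-identityʳ a)) u≤a)))
    walk {s} {δ} {ε} {k} 0<s 0<δ 0<ε δ≡ k≡ (suc n) a s≤a la {u} uu u≤a
      with located (<-+ {a + δ} 0<δ)
    ... | inj₂ u2 = a , (a + δ) + δ , Ratₚ.<-≤-trans 0<s s≤a , la , u2 , (begin
          (a + δ) + δ            ≡⟨ Ratₚ.+-assoc a δ δ ⟩
          a + (δ + δ)            ≤⟨ Ratₚ.+-monoʳ-≤ a (Ratₚ.+-mono-≤ le le) ⟩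
          a + (a * ε + a * ε)    ≡⟨ cong₂ _+_ (Ratₚ.*-identityʳ a) (Ratₚ.*-distribˡ-+ a ε ε) ⟨
          a * 1ℚ + a * (ε + ε)   ≡⟨ Ratₚ.*-distribˡ-+ a 1ℚ (ε + ε) ⟨
          a * (1ℚ + (ε + ε))     ≡⟨ cong (a *_) k≡ ⟩
          a * k                  ∎)
      where
      open Ratₚ.≤-Reasoning
      le : δ ≤ a * ε
      le = subst (_≤ a * ε) (sym δ≡) (*-monoʳ (Ratₚ.<⇒≤ 0<ε) s≤a)
    ... | inj₁ l1 = walk 0<s 0<δ 0<ε δ≡ k≡ n (a + δ) (Ratₚ.≤-trans s≤a (Ratₚ.<⇒≤ (<-+ 0<δ))) l1 uu
        (subst (u ≤_) (begin
          a + fromℕ (suc n) * δ       ≡⟨ cong (λ z → a + z * δ) (fromℕ-suc n) ⟩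
          a + (1ℚ + fromℕ n) * δ      ≡⟨ cong (λ z → a + z) (Ratₚ.*-distribʳ-+ δ 1ℚ (fromℕ n)) ⟩
          a + (1ℚ * δ + fromℕ n * δ)  ≡⟨ cong (λ z → a + (z + fromℕ n * δ)) (Ratₚ.*-identityˡ δ) ⟩
          a + (δ + fromℕ n * δ)       ≡⟨ Ratₚ.+-assoc a δ _ ⟨
          (a + δ) + fromℕ n * δ       ∎) u≤a)
      where open ≡-Reasoning

    close : ∀ {k} → 1ℚ < k → ∃₂ λ s t → 0ℚ < s × lower s × upper t × t ≤ s * k
    close 1<k with lower-open x-pos | upper-inhabited | halve 1<k
    ... | s , 0<s , ls | u , uu | ε , 0<ε , k≡ with divide (*-pos 0<s 0<ε) u
    ... | v , δv≡u with archimedean v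
    ... | N , v≤N = walk 0<s 0<δ 0<ε refl k≡ N s Ratₚ.≤-refl ls uu (begin
        u                           ≡⟨ δv≡u ⟨
        (s * ε) * v                 ≤⟨ *-monoˡ (Ratₚ.<⇒≤ 0<δ) v≤N ⟩
        (s * ε) * fromℕ N           ≡⟨ Ratₚ.*-comm (s * ε) (fromℕ N) ⟩
        fromℕ N * (s * ε)           ≡⟨ Ratₚ.+-identityˡ _ ⟨
        0ℚ + fromℕ N * (s * ε)      ≤⟨ Ratₚ.+-monoˡ-≤ (fromℕ N * (s * ε)) (Ratₚ.<⇒≤ 0<s) ⟩
        s + fromℕ N * (s * ε)       ∎)
      where
      open Ratₚ.≤-Reasoning
      0<δ : 0ℚ < s * ε
      0<δ = *-pos 0<s 0<ε

  -- x^(a/b) : for rational r, s > 0, r ≤ s^(a/b) iff rᵇ ≤ sᵃ.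
  rootPower : (a b : ℕ) → .{{Nat.NonZero b}} → ℝ⁺
  rootPower a b = record
    { lower           = low
    ; upper           = upp
    ; lower-inhabited = 0ℚ , low-0
    ; upper-inhabited = upp-inhabited
    ; lower-closed    = λ { q<r (r′ , s , r<r′ , rest) → r′ , s , Ratₚ.<-trans q<r r<r′ , rest }
    ; upper-closed    = λ { q<r (r′ , s , r′<q , rest) → r′ , s , Ratₚ.<-trans r′<q q<r , rest }
    ; lower-open      = λ { (r , s , q<r , rest) →
                          let m , q<m , m<r = Ratₚ.<-dense q<r in m , q<m , r , s , m<r , rest }
    ; upper-open      = λ { (r , s , r<q , rest) →
                          let m , r<m , m<q = Ratₚ.<-dense r<q in m , m<q , r , s , r<m , rest }
    ; disjoint        = disj
    ; located         = loc
    } , low-0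
    where
    low upp : ℚ → Set
    low q = ∃₂ λ r s → q < r × 0ℚ < r × 0ℚ < s × lower s × r ^ℚ b ≤ s ^ℚ a
    upp q = ∃₂ λ r s → r < q × 0ℚ < r × upper s × s ^ℚ a ≤ r ^ℚ b

    low-0 : low 0ℚ
    low-0 with lower-open x-pos
    ... | s , 0<s , ls with Ratₚ.≤-total 1ℚ (s ^ℚ a)
    ... | inj₁ 1≤ = 1ℚ , s , 0<1 , 0<1 , 0<s , ls , subst (_≤ s ^ℚ a) (sym (1^n b)) 1≤
    ... | inj₂ ≤1 = s ^ℚ a , s , ^-pos a 0<s , ^-pos a 0<s , 0<s , ls , ^≤ b (^-pos a 0<s) ≤1

    upp-inhabited : ∃[ q ] upp q
    upp-inhabited with upper-inhabited
    ... | s , us with Ratₚ.≤-total 1ℚ (s ^ℚ a)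
    ... | inj₁ 1≤ = s ^ℚ a + 1ℚ , s ^ℚ a , s , <-+ 0<1 , ^-pos a (upper-pos us) , us , ≤^ b 1≤
    ... | inj₂ ≤1 = 1ℚ + 1ℚ , 1ℚ , s , <-+ 0<1 , 0<1 , us , subst (s ^ℚ a ≤_) (sym (1^n b)) ≤1

    disj : ∀ {q} → low q → ¬ upp q
    disj (r , s , q<r , 0<r , 0<s , ls , r≤s) (r′ , t , r′<q , 0<r′ , ut , t≤r′) =
      Ratₚ.<-irrefl refl (Ratₚ.<-≤-trans (^-mono-< b 0<r′ (Ratₚ.<-trans r′<q q<r))
        (Ratₚ.≤-trans r≤s (Ratₚ.≤-trans (^-mono a 0<s (Ratₚ.<⇒≤ (lower<upper ls ut))) t≤r′)))

    between : ∀ {q m₁ m₂ r} → 0ℚ < m₁ → q < m₁ → m₁ < m₂ → m₂ < r → low q ⊎ upp r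
    between {q} {m₁} {m₂} 0<m₁ q<m₁ m₁<m₂ m₂<r with ratio 0<m₁ m₁<m₂
    ... | e , 1<e , m₁e≡m₂ with rootBelow a 1<e
    ... | k , 1<k , k^a≤e with close 1<k
    ... | s , t , 0<s , ls , ut , t≤sk with Ratₚ.≤-total (m₁ ^ℚ b) (s ^ℚ a)
    ... | inj₁ m≤s = inj₁ (m₁ , s , q<m₁ , 0<m₁ , 0<s , ls , m≤s)
    ... | inj₂ s≤m = inj₂ (m₂ , t , m₂<r , Ratₚ.<-trans 0<m₁ m₁<m₂ , ut , (begin
        t ^ℚ a              ≤⟨ ^-mono a (upper-pos ut) t≤sk ⟩
        (s * k) ^ℚ a        ≡⟨ *-^ s k a ⟩
        s ^ℚ a * k ^ℚ a     ≤⟨ *-mono (Ratₚ.<⇒≤ (^-pos a (1<⇒0< 1<k)))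
                                      (Ratₚ.<⇒≤ (^-pos b 0<m₁)) s≤m
                                      (Ratₚ.≤-trans k^a≤e (≤^ b (Ratₚ.<⇒≤ 1<e))) ⟩
        m₁ ^ℚ b * e ^ℚ b    ≡⟨ *-^ m₁ e b ⟨
        (m₁ * e) ^ℚ b       ≡⟨ cong (_^ℚ b) m₁e≡m₂ ⟩
        m₂ ^ℚ b             ∎))
      where open Ratₚ.≤-Reasoning

    loc : ∀ {q r} → q < r → low q ⊎ upp r
    loc {q} {r} q<r with 0ℚ Ratₚ.<? q
    ... | no  0≮q with low-0
    ...   | r′ , s , 0<r′ , rest = inj₁ (r′ , s , Ratₚ.≤-<-trans (Ratₚ.≮⇒≥ 0≮q) 0<r′ , rest)
    loc {q} {r} q<r | yes 0<q with Ratₚ.<-dense q<r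
    ... | m₂ , q<m₂ , m₂<r with Ratₚ.<-dense q<m₂
    ... | m₁ , q<m₁ , m₁<m₂ = between (Ratₚ.<-trans 0<q q<m₁) q<m₁ m₁<m₂ m₂<r

  -- ν / x : for rational r, s > 0, r ≤ ν / s iff r s ≤ ν.
  quotient : (ν : ℚ) → 0ℚ < ν → ℝ⁺
  quotient ν 0<ν = record
    { lower           = low
    ; upper           = upp
    ; lower-inhabited = 0ℚ , low-0
    ; upper-inhabited = upp-inhabited
    ; lower-closed    = λ { q<r (r′ , s , r<r′ , rest) → r′ , s , Ratₚ.<-trans q<r r<r′ , rest }
    ; upper-closed    = λ { q<r (r′ , s , r′<q , rest) → r′ , s , Ratₚ.<-trans r′<q q<r , rest }
    ; lower-open      = λ { (r , s , q<r , rest) →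
                          let m , q<m , m<r = Ratₚ.<-dense q<r in m , q<m , r , s , m<r , rest }
    ; upper-open      = λ { (r , s , r<q , rest) →
                          let m , r<m , m<q = Ratₚ.<-dense r<q in m , m<q , r , s , r<m , rest }
    ; disjoint        = disj
    ; located         = loc
    } , low-0
    where
    low upp : ℚ → Set
    low q = ∃₂ λ r s → q < r × upper s × r * s ≤ ν
    upp q = ∃₂ λ r s → r < q × 0ℚ < s × lower s × ν ≤ r * s

    low-0 : low 0ℚ
    low-0 with upper-inhabited
    ... | s , us with divide⁺ (upper-pos us) 0<ν
    ... | r , 0<r , sr≡ν = r , s , 0<r , us , Ratₚ.≤-reflexive (trans (Ratₚ.*-comm r s) sr≡ν)

    upp-inhabited : ∃[ q ] upp q
    upp-inhabited with lower-open x-pos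
    ... | s , 0<s , ls with divide⁺ 0<s 0<ν
    ... | r , 0<r , sr≡ν = r + 1ℚ , r , s , <-+ 0<1 , 0<s , ls ,
                           Ratₚ.≤-reflexive (trans (sym sr≡ν) (Ratₚ.*-comm s r))

    disj : ∀ {q} → low q → ¬ upp q
    disj (r , s , q<r , us , rs≤ν) (r′ , t , r′<q , 0<t , lt , ν≤r′t) =
      Ratₚ.<-irrefl refl (begin-strict
        ν       ≤⟨ ν≤r′t ⟩
        r′ * t  <⟨ *-mono-<ʳ 0<t r′<r ⟩
        r * t   ≤⟨ *-monoˡ (Ratₚ.<⇒≤ 0<r) (Ratₚ.<⇒≤ (lower<upper lt us)) ⟩
        r * s   ≤⟨ rs≤ν ⟩
        ν       ∎)
      where
      open Ratₚ.≤-Reasoning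
      r′<r = Ratₚ.<-trans r′<q q<r
      0<r : 0ℚ < r
      0<r = *-cancelˡ-< 0<t (subst₂ _<_ (sym (Ratₚ.*-zeroʳ t)) (Ratₚ.*-comm r t)
        (Ratₚ.<-trans (Ratₚ.<-≤-trans 0<ν ν≤r′t) (*-mono-<ʳ 0<t r′<r)))

    between : ∀ {q m₁ m₂ r} → 0ℚ < m₁ → q < m₁ → m₁ < m₂ → m₂ < r → low q ⊎ upp r
    between {q} {m₁} {m₂} 0<m₁ q<m₁ m₁<m₂ m₂<r
      with divide⁺ 0<m₁ 0<ν | divide⁺ (Ratₚ.<-trans 0<m₁ m₁<m₂) 0<ν
    ... | v₁ , 0<v₁ , m₁v₁≡ν | v₂ , 0<v₂ , m₂v₂≡ν
      with located (*-cancelˡ-< 0<m₁ (subst (m₁ * v₂ <_) (trans m₂v₂≡ν (sym m₁v₁≡ν)) (*-mono-<ʳ 0<v₂ m₁<m₂)))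
    ... | inj₁ lv = inj₂ (m₂ , v₂ , m₂<r , 0<v₂ , lv , Ratₚ.≤-reflexive (sym m₂v₂≡ν))
    ... | inj₂ uv = inj₁ (m₁ , v₁ , q<m₁ , uv , Ratₚ.≤-reflexive m₁v₁≡ν)

    loc : ∀ {q r} → q < r → low q ⊎ upp r
    loc {q} {r} q<r with 0ℚ Ratₚ.<? q
    ... | no  0≮q with low-0
    ...   | r′ , s , 0<r′ , rest = inj₁ (r′ , s , Ratₚ.≤-<-trans (Ratₚ.≮⇒≥ 0≮q) 0<r′ , rest)
    loc {q} {r} q<r | yes 0<q with Ratₚ.<-dense q<r
    ... | m₂ , q<m₂ , m₂<r with Ratₚ.<-dense q<m₂
    ... | m₁ , q<m₁ , m₁<m₂ = between (Ratₚ.<-trans 0<q q<m₁) q<m₁ m₁<m₂ m₂<r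

infixr 8 _^ᴿ_
infixl 7 _/ᴿ_

_/ᴿ_ : (n : ℕ) → ℝ⁺ → .{{Nat.NonZero n}} → ℝ⁺
n /ᴿ (x , 0<x) = quotient x 0<x (fromℕ n) (fromℕ-pos n)

_^ᴿ_ : ℝ⁺ → ℚ → ℝ⁺
(x , 0<x) ^ᴿ mkℚ (+ a)    b-1 _ = rootPower x 0<x a (suc b-1)
(x , 0<x) ^ᴿ mkℚ -[1+ a ] b-1 _ = 1 /ᴿ rootPower x 0<x (suc a) (suc b-1)

-- (log₂ n)^β is a positive real only for n ≥ 2.
n/log₂^ : ℚ → (n : ℕ) → .{{NonTrivial n}} → ℝ
n/log₂^ β n = proj₁ ((n /ᴿ (log₂ n ^ᴿ β)) {{Nat.nonTrivial⇒nonZero n}})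

NondecreasingFrom : ℕ → ((n : ℕ) → .{{NonTrivial n}} → ℝ) → Set
NondecreasingFrom a f = ∀ m n .{{_ : NonTrivial m}} .{{_ : NonTrivial n}} →
                        a Nat.≤ m → m Nat.≤ n → f m ≤ᴿ f n

-- Finitely many values of f do not matter for COMPLEX and SC, so those
-- below a cutoff a, where f is undefined or not yet nondecreasing, are
-- set to f(a).
setBelow : (a : ℕ) → .{{NonTrivial a}} → ((n : ℕ) → .{{NonTrivial n}} → ℝ) → ℕ → ℝ
setBelow a f n = f (a Nat.⊔ n)
  {{Nat.n>1⇒nonTrivial (Natₚ.≤-trans (Nat.nonTrivial⇒n>1 a) (Natₚ.m≤m⊔n a n))}}

-- K(σ) ≥ x - c, written as x ≤ K(σ) + c.
K[_]_≥_-_ : Machine → String → ℝ → ℕ → Set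
K[ U ] σ ≥ x - c = ∀ k → IsK U σ k → x ≤ᴿ fromℚ (fromℕ (k Nat.+ c))

infix 9 _↾_

_↾_ : (ℕ → Bool) → ℕ → String
X ↾ n = applyUpTo X n

substring : (ℕ → Bool) → ℕ → ℕ → String
substring X i n = applyUpTo (λ j → X (i Nat.+ j)) n

_IsSubstringOf_ : String → (ℕ → Bool) → Set
τ IsSubstringOf X = ∃₂ λ i n → τ ≡ substring X i n

COMPLEX : Machine → (ℕ → ℝ) → Pred (ℕ → Bool) 0ℓ
COMPLEX U f X = ∃[ c ] (∀ n → K[ U ] (X ↾ n) ≥ f n - c)

SC : Machine → (ℕ → ℝ) → Pred (ℕ → Bool) 0ℓ
SC U f X = ∃[ c ] (∀ τ → τ IsSubstringOf X → K[ U ] τ ≥ f (length τ) - c)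

{-# OPTIONS --safe #-}
module Submission where

-- The output is a Toeplitz sequence: position i belongs to the level t given by the number of
-- trailing ones of i, level t is shared evenly by 2^(D(t+1)) streams, and stream K repeats the
-- first 2^K bits of X forever.  With 2^(Dt) ≤ K < 2^(D(t+1)), stream K has density about
-- K^-(1+1/D), so every substring τ of length n = C · 2^K · K^(1+1/D) contains X ↾ 2^K along an
-- arithmetic progression.  A program for τ and O(K) bits describing the progression yield
-- X ↾ 2^K; hence K(τ) ≥ 2^K / K^α - O(K), which exceeds n / (log₂ n)^β for large K as soon as
-- 1 + 1/D < β - α.

-- The exponent is `1 + 1/D` and not `1` because all streams share the positions of one sequence:
-- their densities must be summable, and `1/K` is not. Level `t` has density `2^-(t+1)`; split among
-- `2^(D(t+1))` streams it leaves each `2^-((D+1)(t+1))`, which is at least a constant times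
-- `K^-(1+1/D)` when `2^(Dt) ≤ K`. Increasing `D` approaches the harmonic borderline, so any gap
-- `β - α > 1` suffices. A substring may start at any phase of a stream. Since the stream repeats, a
-- window of two full periods still contains one whole copy of `X ↾ 2^K`, and only its offset has to
-- be described. Prefix lengths are powers of two because `log₂ 2^K = K` exactly: membership in the
-- Dedekind cuts then becomes an inequality between natural numbers. Other lengths are reached
-- through the assumed monotonicity.

open import Defs
open import Data.Bool.Base using (Bool; true; false)
open import Data.Empty using (⊥-elim)
open import Data.Fin.Base using (Fin; zero; suc)
open import Data.Fin.Patterns using (0F; 1F; 2F; 3F; 4F; 5F)
open import Data.List.Base using ([]; _∷_; _++_; length; applyUpTo)
open import Data.List.Properties using (length-++; length-applyUpTo)
open import Data.List.Relation.Binary.Prefix.Heterogeneous using (Prefix; []; _∷_)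
open import Data.Nat.Base using (ℕ; zero; suc; NonTrivial; NonZero)
import Data.Nat.Base as Nat
open import Data.Nat.Coprimality using (Coprime)
open import Data.Nat.GeneralisedArithmetic using (fold; fold-+)
open import Data.Nat.Induction using (<-rec)
open import Data.Nat.Solver using (module +-*-Solver)
open import Data.Product.Base using (∃; ∃₂; ∃-syntax; _×_; _,_; proj₁; proj₂)
open import Data.Rational.Base using (ℚ; mkℚ; 0ℚ; 1ℚ; ↥_; ↧ₙ_)
import Data.Rational.Base as Rat
import Data.Rational.Properties as Ratₚ
open import Data.Sum.Base using (_⊎_; inj₁; inj₂)
open import Data.Vec.Base using (Vec; []; _∷_; lookup)
open import Data.Vec.Relation.Binary.Pointwise.Inductive using (Pointwise; []; _∷_)
open import Function.Base using (_∘_)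
open import Function.Bundles using (Equivalence)
open import Relation.Binary.Definitions using (tri<; tri≈; tri>)
open import Relation.Binary.PropositionalEquality
open import Relation.Nullary using (¬_; yes; no)
open import Relation.Nullary.Decidable using (decidable-stable)

-- Arithmetic and strings

module _ where

  open import Data.Nat.Base
  open import Data.Nat.Properties

  1+n≤2*n : ∀ {n} → 1 ≤ n → suc n ≤ 2 * n
  1+n≤2*n {n} 1≤n = +-mono-≤ 1≤n (≤-reflexive (sym (+-identityʳ n)))

  n<2^n : ∀ n → n < 2 ^ n
  n<2^n zero    = s≤s z≤n
  n<2^n (suc n) = +-mono-≤ (m^n>0 2 n) (≤-trans (n<2^n n) (m≤m+n _ 0))

  2^-cancel-≤ : ∀ {m n} → 2 ^ m ≤ 2 ^ n → m ≤ n
  2^-cancel-≤ 2^m≤2^n = ≮⇒≥ λ n<m → <⇒≱ (^-monoʳ-< 2 (s≤s (s≤s z≤n)) n<m) 2^m≤2^n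

  -- A discrete intermediate value theorem. It chooses the level of a stream and, for a given
  -- substring length, the stream to read.
  crossing : ∀ (f : ℕ → ℕ) {n} i m → f i ≤ n → n < f (i + m) →
             ∃[ j ] (i ≤ j × f j ≤ n × n < f (suc j))
  crossing f i zero    fi≤n n<f = ⊥-elim (<⇒≱ n<f (subst (λ j → f j ≤ _) (sym (+-identityʳ i)) fi≤n))
  crossing f {n} i (suc m) fi≤n n<f with f (suc i) ≤? n
  ... | no  fi+1≰n = i , ≤-refl , fi≤n , ≰⇒> fi+1≰n
  ... | yes fi+1≤n with crossing f (suc i) m fi+1≤n (subst (λ j → n < f j) (+-suc i m) n<f)
  ...   | j , i<j , fj≤n , n<fj+1 = j , <⇒≤ i<j , fj≤n , n<fj+1

  -- Parity, halving and blocks of binary digits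

  odd : ℕ → ℕ
  odd zero    = 0
  odd (suc n) = 1 ∸ odd n

  half : ℕ → ℕ
  half zero    = 0
  half (suc n) = odd n + half n

  odd-2* : ∀ n → odd (2 * n) ≡ 0
  odd-2* zero    = refl
  odd-2* (suc n) rewrite +-suc n (n + 0) | odd-2* n = refl

  odd-1+2* : ∀ n → odd (1 + 2 * n) ≡ 1
  odd-1+2* n = cong (1 ∸_) (odd-2* n)

  half-2* : ∀ n → half (2 * n) ≡ n
  half-2* zero    = refl
  half-2* (suc n) rewrite +-suc n (n + 0) | odd-2* n = cong suc (half-2* n)

  half-1+2* : ∀ n → half (1 + 2 * n) ≡ n
  half-1+2* n rewrite odd-2* n = half-2* n

  odd-view : ∀ n → odd n ≡ 0 ⊎ odd n ≡ 1
  odd-view zero    = inj₁ refl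
  odd-view (suc n) with odd-view n
  ... | inj₁ eq rewrite eq = inj₂ refl
  ... | inj₂ eq rewrite eq = inj₁ refl

  odd+2*half : ∀ n → odd n + 2 * half n ≡ n
  odd+2*half zero    = refl
  odd+2*half (suc n) with odd-view n | odd+2*half n
  ... | inj₁ eq | ih rewrite eq = cong suc ih
  ... | inj₂ eq | ih rewrite eq = cong suc (trans (+-suc (half n) (half n + 0)) ih)

  odd≤1 : ∀ n → odd n ≤ 1
  odd≤1 zero    = z≤n
  odd≤1 (suc n) = m∸n≤m 1 (odd n)

  half≤pred : ∀ n → half n ≤ pred n
  half≤pred zero    = z≤n
  half≤pred (suc n) with odd-view n | odd+2*half n
  ... | inj₁ eq | ih rewrite eq = subst (half n ≤_) ih (m≤m+n _ _)
  ... | inj₂ eq | ih rewrite eq = subst (suc (half n) ≤_) ih (s≤s (m≤m+n _ _))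

  fold-suc : ∀ {A : Set} (z : A) (s : A → A) n → fold z s (suc n) ≡ fold (s z) s n
  fold-suc z s n = trans (cong (fold z s) (+-comm 1 n)) (fold-+ z s n)

  high : ℕ → ℕ → ℕ
  high s n = fold n half s

  low : ℕ → ℕ → ℕ
  low s n = n ∸ 2 ^ s * high s n

  high≤ : ∀ s n → high s n ≤ n ∸ s
  high≤ zero    n = ≤-refl
  high≤ (suc s) n = ≤-trans (half≤pred (high s n))
    (subst (pred (high s n) ≤_) (pred[m∸n]≡m∸[1+n] n s) (pred-mono-≤ (high≤ s n)))

  high-+* : ∀ s {k} q → k < 2 ^ s → high s (k + 2 ^ s * q) ≡ q
  high-+* zero    {zero}  q _         = +-identityʳ q
  high-+* zero    {suc _} q (s≤s ())
  high-+* (suc s) {k} q k<2^s = begin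
    high (suc s) (k + 2 ^ suc s * q)       ≡⟨ fold-suc _ half s ⟩
    high s (half (k + 2 * 2 ^ s * q))      ≡⟨ cong (high s ∘ half) eq ⟩
    high s (half (odd k + 2 * (half k + 2 ^ s * q))) ≡⟨ cong (high s) (half-odd (odd-view k)) ⟩
    high s (half k + 2 ^ s * q)            ≡⟨ high-+* s q half< ⟩
    q                                      ∎
    where
    open ≡-Reasoning
    eq : k + 2 * 2 ^ s * q ≡ odd k + 2 * (half k + 2 ^ s * q)
    eq = begin
      k + 2 * 2 ^ s * q                          ≡⟨ cong₂ _+_ (sym (odd+2*half k)) (*-assoc 2 (2 ^ s) q) ⟩
      (odd k + 2 * half k) + 2 * (2 ^ s * q)     ≡⟨ +-assoc (odd k) _ _ ⟩
      odd k + (2 * half k + 2 * (2 ^ s * q))     ≡⟨ cong (odd k +_) (*-distribˡ-+ 2 (half k) _) ⟨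
      odd k + 2 * (half k + 2 ^ s * q)           ∎
    half-odd : ∀ {o x} → o ≡ 0 ⊎ o ≡ 1 → half (o + 2 * x) ≡ x
    half-odd (inj₁ refl) = half-2* _
    half-odd (inj₂ refl) = half-1+2* _
    half< : half k < 2 ^ s
    half< = *-cancelˡ-< 2 _ _ (≤-<-trans (subst (2 * half k ≤_) (odd+2*half k) (m≤n+m _ (odd k))) k<2^s)

  low-+* : ∀ s {k} q → k < 2 ^ s → low s (k + 2 ^ s * q) ≡ k
  low-+* s {k} q k<2^s = trans (cong (λ h → k + 2 ^ s * q ∸ 2 ^ s * h) (high-+* s q k<2^s)) (m+n∸n≡m k (2 ^ s * q))

  -- In binary: the digits of j, then a 0, then t ones.
  pair : ℕ → ℕ → ℕ
  pair zero    j = 2 * j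
  pair (suc t) j = 1 + 2 * pair t j

  half-pair : ∀ t j → half (pair (suc t) j) ≡ pair t j
  half-pair t j = half-1+2* (pair t j)

  high-pair : ∀ t j → high (suc t) (pair t j) ≡ j
  high-pair zero    j = half-2* j
  high-pair (suc t) j = trans (fold-suc _ half (suc t)) (trans (cong (high (suc t)) (half-pair t j)) (high-pair t j))

  odd-high-pair : ∀ t j → odd (high t (pair t j)) ≡ 0
  odd-high-pair zero    j = odd-2* j
  odd-high-pair (suc t) j = trans (cong odd (fold-suc _ half t))
    (trans (cong (odd ∘ high t) (half-pair t j)) (odd-high-pair t j))

  odd-high-pair< : ∀ t j x → x < t → odd (high x (pair t j)) ≡ 1
  odd-high-pair< (suc t) j zero    _         = odd-1+2* (pair t j)
  odd-high-pair< (suc t) j (suc x) (s≤s x<t) = trans (cong odd (fold-suc _ half x))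
    (trans (cong (odd ∘ high x) (half-pair t j)) (odd-high-pair< t j x x<t))

  -- Consecutive ranks of level `t` lie `2 ^ suc t` apart, so a congruence condition on ranks
  -- becomes an arithmetic progression of positions.
  pair-+* : ∀ t j x → pair t (j + x) ≡ pair t j + 2 ^ suc t * x
  pair-+* zero    j x = *-distribˡ-+ 2 j x
  pair-+* (suc t) j x = cong suc (begin
    2 * pair t (j + x)                      ≡⟨ cong (2 *_) (pair-+* t j x) ⟩
    2 * (pair t j + 2 ^ suc t * x)          ≡⟨ *-distribˡ-+ 2 (pair t j) _ ⟩
    2 * pair t j + 2 * (2 ^ suc t * x)      ≡⟨ cong (2 * pair t j +_) (*-assoc 2 (2 ^ suc t) x) ⟨
    2 * pair t j + 2 ^ suc (suc t) * x      ∎)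
    where open ≡-Reasoning

  -- Pairing appends `suc t` digits. It bounds both the first position of a stream and the length of
  -- the description of a progression.
  pair< : ∀ t {j x} → j < x → pair t j < 2 ^ suc t * x
  pair< zero    j<x = *-monoʳ-< 2 j<x
  pair< (suc t) {j} {x} j<x = begin-strict
    1 + 2 * pair t j       <⟨ n<1+n _ ⟩
    2 + 2 * pair t j       ≡⟨ *-suc 2 (pair t j) ⟨
    2 * suc (pair t j)     ≤⟨ *-monoʳ-≤ 2 (pair< t j<x) ⟩
    2 * (2 ^ suc t * x)    ≡⟨ *-assoc 2 (2 ^ suc t) x ⟨
    2 ^ suc (suc t) * x    ∎
    where open ≤-Reasoning

  -- Mirrors the premises of `mu↓`, where each earlier value is exhibited as a successor.
  IsLeastZero : (ℕ → ℕ) → ℕ → Set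
  IsLeastZero f y = (∀ x → x < y → ∃[ z ] f x ≡ suc z) × f y ≡ 0

  leastZero : ∀ f n → f n ≡ 0 → ∃ (IsLeastZero f)
  leastZero f zero    fn≡0 = 0 , (λ _ ()) , fn≡0
  leastZero f (suc n) fn≡0 with f 0 in eq
  ... | zero  = 0 , (λ _ ()) , eq
  ... | suc z with leastZero (f ∘ suc) n fn≡0
  ...   | y , below , fy≡0 = suc y , (λ { zero _ → z , eq ; (suc x) (s≤s x<y) → below x x<y }) , fy≡0

  leastZero-unique : ∀ {f x y} → IsLeastZero f x → IsLeastZero f y → x ≡ y
  leastZero-unique {f} {x} {y} (below-x , fx≡0) (below-y , fy≡0) with <-cmp x y
  ... | tri< x<y _ _ with () ← trans (sym fx≡0) (proj₂ (below-y x x<y))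
  ... | tri≈ _ x≡y _ = x≡y
  ... | tri> _ _ y<x with () ← trans (sym fy≡0) (proj₂ (below-x y y<x))

  -- The search ends by `t = n`: after `n` halvings nothing is left, and 0 is even.
  unpair₁-spec : ∀ n → ∃ (IsLeastZero (λ t → odd (high t n)))
  unpair₁-spec n = leastZero _ n (cong odd (n≤0⇒n≡0 (subst (high n n ≤_) (n∸n≡0 n) (high≤ n n))))

  unpair₁ : ℕ → ℕ
  unpair₁ n = proj₁ (unpair₁-spec n)

  unpair₂ : ℕ → ℕ
  unpair₂ n = high (suc (unpair₁ n)) n

  unpair₁-pair : ∀ t j → unpair₁ (pair t j) ≡ t
  unpair₁-pair t j = leastZero-unique (proj₂ (unpair₁-spec (pair t j)))
    ((λ x x<t → 0 , odd-high-pair< t j x x<t) , odd-high-pair t j)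

  unpair₂-pair : ∀ t j → unpair₂ (pair t j) ≡ j
  unpair₂-pair t j = trans (cong (λ s → high (suc s) (pair t j)) (unpair₁-pair t j)) (high-pair t j)

  -- Reading the bits of a string off its code

  tail : ℕ → ℕ
  tail n = half (pred n)

  drop : ℕ → ℕ → ℕ
  drop k n = fold n tail k

  tail-code : ∀ b σ → tail (code (b ∷ σ)) ≡ code σ
  tail-code false σ = half-2* (code σ)
  tail-code true  σ = half-1+2* (code σ)

  2∸odd-code : ∀ b σ → 2 ∸ odd (code (b ∷ σ)) ≡ suc (bit b)
  2∸odd-code false σ = cong (2 ∸_) (odd-1+2* (code σ))
  2∸odd-code true  σ = cong (λ o → 2 ∸ (1 ∸ o)) (odd-1+2* (code σ))

  code-∷ : ∀ b σ → code (b ∷ σ) ≡ suc (bit b) + 2 * code σ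
  code-∷ false σ = refl
  code-∷ true  σ = refl

  -- The code of the last j of the m bits of n at positions i, i + p, i + 2p, …; working
  -- backwards makes this primitive recursive in j.
  gatherLast : ℕ → ℕ → ℕ → ℕ → ℕ → ℕ
  gatherLast zero    n i p m = 0
  gatherLast (suc j) n i p m = (2 ∸ odd (drop (i + p * (m ∸ suc j)) n)) + 2 * gatherLast j n i p m

  gather : ℕ → ℕ → ℕ → ℕ → ℕ
  gather n i p m = gatherLast m n i p m

  -- By the truncated subtraction, positions beyond the end count as true.
  HasBit : ℕ → ℕ → Bool → Set
  HasBit n i b = 2 ∸ odd (drop i n) ≡ suc (bit b)

  gather-code : ∀ n i p m (e : ℕ → Bool) → (∀ j → j < m → HasBit n (i + p * j) (e j)) →
                gather n i p m ≡ code (applyUpTo e m)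
  gather-code n i p m e bits = last m 0 e refl bits
    where
    last : ∀ j s (e : ℕ → Bool) → s + j ≡ m → (∀ x → x < j → HasBit n (i + p * (s + x)) (e x)) →
           gatherLast j n i p m ≡ code (applyUpTo e j)
    last zero    s e eq bits = refl
    last (suc j) s e eq bits = begin
      (2 ∸ odd (drop (i + p * (m ∸ suc j)) n)) + 2 * gatherLast j n i p m
        ≡⟨ cong₂ (λ x y → (2 ∸ odd (drop (i + p * x) n)) + 2 * y) m∸1+j≡s+0
             (last j (suc s) (e ∘ suc) (trans (sym (+-suc s j)) eq)
               (λ x x<j → subst (λ y → HasBit n (i + p * y) (e (suc x))) (+-suc s x) (bits (suc x) (s≤s x<j)))) ⟩
      (2 ∸ odd (drop (i + p * (s + 0)) n)) + 2 * code (applyUpTo (e ∘ suc) j)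
        ≡⟨ cong (_+ 2 * code (applyUpTo (e ∘ suc) j)) (bits 0 (s≤s z≤n)) ⟩
      suc (bit (e 0)) + 2 * code (applyUpTo (e ∘ suc) j)
        ≡⟨ code-∷ (e 0) _ ⟨
      code (applyUpTo e (suc j)) ∎
      where
      open ≡-Reasoning
      m∸1+j≡s+0 : m ∸ suc j ≡ s + 0
      m∸1+j≡s+0 = trans (cong (_∸ suc j) (sym eq)) (trans (m+n∸n≡m s (suc j)) (sym (+-identityʳ s)))

  HasBit-applyUpTo : ∀ (f : ℕ → Bool) n i → i < n → HasBit (code (applyUpTo f n)) i (f i)
  HasBit-applyUpTo f (suc n) zero    _         = 2∸odd-code (f 0) _
  HasBit-applyUpTo f (suc n) (suc i) (s≤s i<n) =
    subst (λ x → 2 ∸ odd x ≡ suc (bit (f (suc i))))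
      (sym (trans (fold-suc _ tail i) (cong (drop i) (tail-code (f 0) _))))
      (HasBit-applyUpTo (f ∘ suc) n i i<n)

  decode : ∀ n → ∃[ σ ] code σ ≡ n
  decode n = go n n ≤-refl
    where
    go : ∀ fuel n → n ≤ fuel → ∃[ σ ] code σ ≡ n
    go _          zero    _ = [] , refl
    go (suc fuel) (suc n) (s≤s n≤fuel)
      with go fuel (half n) (≤-trans (half≤pred n) (≤-trans pred[n]≤n n≤fuel)) | odd-view n | odd+2*half n
    ... | σ , eq | inj₁ even | sum rewrite even = false ∷ σ , cong suc (trans (cong (2 *_) eq) sum)
    ... | σ , eq | inj₂ odd′ | sum rewrite odd′ = true ∷ σ , cong suc (trans (cong (λ c → suc (2 * c)) eq) sum)

  -- In bijective numeration the codes of the strings of length `ℓ` begin at `2^ℓ - 1`.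
  2^length≤1+code : ∀ σ → 2 ^ length σ ≤ suc (code σ)
  2^length≤1+code []      = ≤-refl
  2^length≤1+code (b ∷ σ) = begin
    2 * 2 ^ length σ            ≤⟨ *-monoʳ-≤ 2 (2^length≤1+code σ) ⟩
    2 * suc (code σ)            ≡⟨ *-suc 2 (code σ) ⟩
    2 + 2 * code σ              ≤⟨ s≤s (s≤s (m≤n+m _ (bit b))) ⟩
    suc (suc (bit b) + 2 * code σ)  ≡⟨ cong suc (code-∷ b σ) ⟨
    suc (code (b ∷ σ))          ∎
    where open ≤-Reasoning

-- Partial recursive functions

module _ where

  open import Data.Nat.Base
  open import Data.Nat.Properties

  mutual

    deterministic : ∀ {k n} {F : Fin k → ℕ → ℕ} {f : PartialRecursive k n} {xs y z} →
                    F ⊢ f [ xs ]↓ y → F ⊢ f [ xs ]↓ z → y ≡ z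
    deterministic zero↓   zero↓   = refl
    deterministic suc↓    suc↓    = refl
    deterministic proj↓   proj↓   = refl
    deterministic oracle↓ oracle↓ = refl
    deterministic (compose↓ gs↓ f↓) (compose↓ gs↓′ f↓′) with deterministic* gs↓ gs↓′
    ... | refl = deterministic f↓ f↓′
    deterministic (base↓ f↓) (base↓ f↓′) = deterministic f↓ f↓′
    deterministic (step↓ r↓ g↓) (step↓ r↓′ g↓′) with deterministic r↓ r↓′
    ... | refl = deterministic g↓ g↓′
    deterministic {y = y} {z} (mu↓ below↓ y↓) (mu↓ below↓′ z↓) with <-cmp y z
    ... | tri< y<z _ _ with () ← deterministic y↓ (proj₂ (below↓′ y y<z))
    ... | tri≈ _ y≡z _ = y≡z
    ... | tri> _ _ z<y with () ← deterministic z↓ (proj₂ (below↓ z z<y))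

    deterministic* : ∀ {k m n} {F : Fin k → ℕ → ℕ} {gs : Vec (PartialRecursive k n) m} {xs ys zs} →
                     Pointwise (λ g y → F ⊢ g [ xs ]↓ y) gs ys →
                     Pointwise (λ g z → F ⊢ g [ xs ]↓ z) gs zs → ys ≡ zs
    deterministic* []         []           = refl
    deterministic* (g↓ ∷ gs↓) (g↓′ ∷ gs↓′) = cong₂ _∷_ (deterministic g↓ g↓′) (deterministic* gs↓ gs↓′)

  -- The program is uniform in the number of oracles: machines need `k = 0`, the reduction needs
  -- `k = 1`.
  record Computable {n} (f : Vec ℕ n → ℕ) : Set where
    field
      program  : ∀ {k} → PartialRecursive k n
      computes : ∀ {k} {F : Fin k → ℕ → ℕ} xs → F ⊢ program [ xs ]↓ f xs

  open Computable public

  Op : ℕ → Set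
  Op zero    = ℕ
  Op (suc n) = ℕ → Op n

  apply : ∀ {n} → Op n → (Fin n → ℕ) → ℕ
  apply {zero}  f ρ = f
  apply {suc n} f ρ = apply (f (ρ zero)) (ρ ∘ suc)

  -- Computable for curried functions; a record, so that f can be inferred.
  record ComputableOp n (f : Op n) : Set where
    constructor op
    field
      uncurried : Computable {n} (λ xs → apply f (lookup xs))

  open ComputableOp public

  arg : ∀ {n} (i : Fin n) → Computable (λ xs → lookup xs i)
  arg i .program    = proj i
  arg i .computes _ = proj↓

  module _ {n : ℕ} where

    app₁ : ∀ {f} {a : Vec ℕ n → ℕ} → ComputableOp 1 f → Computable a →
           Computable (λ xs → f (a xs))
    app₁ (op f) a .program     = compose (f .program) (a .program ∷ [])
    app₁ (op f) a .computes xs =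
      compose↓ (a .computes xs ∷ []) (f .computes _)

    app₂ : ∀ {f} {a b : Vec ℕ n → ℕ} → ComputableOp 2 f → Computable a → Computable b →
           Computable (λ xs → f (a xs) (b xs))
    app₂ (op f) a b .program     = compose (f .program) (a .program ∷ b .program ∷ [])
    app₂ (op f) a b .computes xs =
      compose↓ (a .computes xs ∷ b .computes xs ∷ []) (f .computes _)

    app₄ : ∀ {f} {a b c d : Vec ℕ n → ℕ} → ComputableOp 4 f →
           Computable a → Computable b → Computable c → Computable d →
           Computable (λ xs → f (a xs) (b xs) (c xs) (d xs))
    app₄ (op f) a b c d .program =
      compose (f .program) (a .program ∷ b .program ∷ c .program ∷ d .program ∷ [])
    app₄ (op f) a b c d .computes xs =
      compose↓ (a .computes xs ∷ b .computes xs ∷ c .computes xs ∷ d .computes xs ∷ []) (f .computes _)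

    app₅ : ∀ {f} {a b c d e : Vec ℕ n → ℕ} → ComputableOp 5 f →
           Computable a → Computable b → Computable c → Computable d → Computable e →
           Computable (λ xs → f (a xs) (b xs) (c xs) (d xs) (e xs))
    app₅ (op f) a b c d e .program =
      compose (f .program) (a .program ∷ b .program ∷ c .program ∷ d .program ∷ e .program ∷ [])
    app₅ (op f) a b c d e .computes xs =
      compose↓ (a .computes xs ∷ b .computes xs ∷ c .computes xs ∷ d .computes xs ∷ e .computes xs ∷ []) (f .computes _)

  primrecᶜ : ∀ {n} {h : Vec ℕ (suc n) → ℕ} {f g} → Computable f → Computable g →
             (∀ xs → h (0 ∷ xs) ≡ f xs) → (∀ x xs → h (suc x ∷ xs) ≡ g (x ∷ h (x ∷ xs) ∷ xs)) →
             Computable h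
  primrecᶜ f g base step .program = primrec (f .program) (g .program)
  primrecᶜ {h = h} f g base step .computes {F = F} (x ∷ xs) = go x
    where
    go : ∀ x → F ⊢ primrec (f .program) (g .program) [ x ∷ xs ]↓ h (x ∷ xs)
    go zero    = base↓ (subst (F ⊢ f .program [ xs ]↓_) (sym (base xs)) (f .computes xs))
    go (suc x) = step↓ (go x) (subst (F ⊢ g .program [ x ∷ h (x ∷ xs) ∷ xs ]↓_) (sym (step x xs)) (g .computes _))

  mu-least : ∀ {k n f} {F : Fin k → ℕ → ℕ} (fᶜ : Computable f) {xs : Vec ℕ n} {y} →
             IsLeastZero (λ x → f (x ∷ xs)) y → F ⊢ mu (fᶜ .program) [ xs ]↓ y
  mu-least {F = F} fᶜ {xs} {y} (below , least) = mu↓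
    (λ x x<y → let z , eq = below x x<y in z , subst (F ⊢ fᶜ .program [ x ∷ xs ]↓_) eq (fᶜ .computes _))
    (subst (F ⊢ fᶜ .program [ y ∷ xs ]↓_) least (fᶜ .computes _))

  -- Determinism turns the premises of an arbitrary derivation into equations about `f`. This is how
  -- a converging delimiter search reveals the shape of its input.
  mu-least⁻¹ : ∀ {k n f} {F : Fin k → ℕ → ℕ} (fᶜ : Computable f) {xs : Vec ℕ n} {y} →
               F ⊢ mu (fᶜ .program) [ xs ]↓ y → IsLeastZero (λ x → f (x ∷ xs)) y
  mu-least⁻¹ fᶜ (mu↓ below↓ y↓) =
    (λ x x<y → let z , x↓ = below↓ x x<y in z , deterministic (fᶜ .computes _) x↓) ,
    deterministic (fᶜ .computes _) y↓

  muᶜ : ∀ {n f} {h : Vec ℕ n → ℕ} → Computable f → (∀ xs → IsLeastZero (λ x → f (x ∷ xs)) (h xs)) →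
        Computable h
  muᶜ f least .program     = mu (f .program)
  muᶜ f least .computes xs = mu-least f (least xs)

  zeroᶜ : ∀ {n} → Computable {n} (λ _ → 0)
  zeroᶜ .program    = compose zeroᶠ []
  zeroᶜ .computes _ = compose↓ [] zero↓

  sucᶜ : ComputableOp 1 suc
  sucᶜ .uncurried .program           = sucᶠ
  sucᶜ .uncurried .computes (_ ∷ []) = suc↓

  constᶜ : ∀ {n} c → Computable {n} (λ _ → c)
  constᶜ zero    = zeroᶜ
  constᶜ (suc c) = app₁ sucᶜ (constᶜ c)

  +ᶜ : ComputableOp 2 _+_
  +ᶜ = op (primrecᶜ (arg 0F) (app₁ sucᶜ (arg 1F)) (λ _ → refl) (λ _ _ → refl))

  *ᶜ : ComputableOp 2 _*_
  *ᶜ = op (primrecᶜ zeroᶜ (app₂ +ᶜ (arg 2F) (arg 1F)) (λ _ → refl) (λ _ _ → refl))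

  predᶜ : ComputableOp 1 pred
  predᶜ = op (primrecᶜ zeroᶜ (arg 0F) (λ _ → refl) (λ _ _ → refl))

  ∸ᶜ : ComputableOp 2 _∸_
  ∸ᶜ = op (app₂ flipped (arg 1F) (arg 0F))
    where
    flipped : ComputableOp 2 (λ y x → x ∸ y)
    flipped = op (primrecᶜ (arg 0F) (app₁ predᶜ (arg 1F))
      (λ _ → refl) (λ { y (x ∷ []) → sym (pred[m∸n]≡m∸[1+n] x y) }))

  2^ᶜ : ComputableOp 1 (2 ^_)
  2^ᶜ = op (primrecᶜ (constᶜ 1) (app₂ *ᶜ (constᶜ 2) (arg 1F)) (λ _ → refl) (λ _ _ → refl))

  oddᶜ : ComputableOp 1 odd
  oddᶜ = op (primrecᶜ zeroᶜ (app₂ ∸ᶜ (constᶜ 1) (arg 1F)) (λ _ → refl) (λ _ _ → refl))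

  halfᶜ : ComputableOp 1 half
  halfᶜ = op (primrecᶜ zeroᶜ (app₂ +ᶜ (app₁ oddᶜ (arg 0F)) (arg 1F)) (λ _ → refl) (λ _ _ → refl))

  foldᶜ : ∀ {s} → ComputableOp 1 s → ComputableOp 2 (λ k n → fold n s k)
  foldᶜ s = op (primrecᶜ (arg 0F) (app₁ s (arg 1F)) (λ _ → refl) (λ _ _ → refl))

  highᶜ : ComputableOp 2 high
  highᶜ = foldᶜ halfᶜ

  tailᶜ : ComputableOp 1 tail
  tailᶜ = op (app₁ halfᶜ (predᶜ .uncurried))

  dropᶜ : ComputableOp 2 drop
  dropᶜ = foldᶜ tailᶜ

  lowᶜ : ComputableOp 2 low
  lowᶜ = op (app₂ ∸ᶜ (arg 1F) (app₂ *ᶜ (app₁ 2^ᶜ (arg 0F)) (highᶜ .uncurried)))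

  unpair₁ᶜ : ComputableOp 1 unpair₁
  unpair₁ᶜ = op (muᶜ (app₁ oddᶜ (highᶜ .uncurried)) (λ { (n ∷ []) → proj₂ (unpair₁-spec n) }))

  unpair₂ᶜ : ComputableOp 1 unpair₂
  unpair₂ᶜ = op (app₂ highᶜ (app₁ sucᶜ (unpair₁ᶜ .uncurried)) (arg 0F))

  gatherLastᶜ : ComputableOp 5 gatherLast
  gatherLastᶜ = op (primrecᶜ zeroᶜ
    (app₂ +ᶜ
      (app₂ ∸ᶜ (constᶜ 2) (app₁ oddᶜ (app₂ dropᶜ
        (app₂ +ᶜ (arg 3F) (app₂ *ᶜ (arg 4F) (app₂ ∸ᶜ (arg 5F) (app₁ sucᶜ (arg 0F))))) (arg 2F))))
      (app₂ *ᶜ (constᶜ 2) (arg 1F)))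
    (λ _ → refl) (λ _ _ → refl))

  gatherᶜ : ComputableOp 4 gather
  gatherᶜ = op (app₅ gatherLastᶜ (arg 3F) (arg 0F) (arg 1F) (arg 2F) (arg 3F))

-- Postprocessing the output of a universal machine

module _ where

  open import Data.Nat.Base
  open import Data.Nat.Properties

  -- Writes w as 1 w₀ 1 w₁ … 0.  On an input with no 0 at an even position the search for the
  -- delimiter diverges, so exactly the strings prepend w π get past it.
  prepend : String → String → String
  prepend []      π = false ∷ π
  prepend (b ∷ w) π = true ∷ b ∷ prepend w π

  length-prepend : ∀ w π → length (prepend w π) ≡ suc (2 * length w) + length π
  length-prepend []      π = refl
  length-prepend (b ∷ w) π = trans (cong (2 +_) (length-prepend w π))
    (cong (λ n → suc n + length π) (sym (*-suc 2 (length w))))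

  prepend-prefix : ∀ w w′ {π π′} → Prefix _≡_ (prepend w π) (prepend w′ π′) → w ≡ w′ × Prefix _≡_ π π′
  prepend-prefix []      []        (_ ∷ p) = refl , p
  prepend-prefix []      (_ ∷ _)   (() ∷ _)
  prepend-prefix (_ ∷ _) []        (() ∷ _)
  prepend-prefix (b ∷ w) (b′ ∷ w′) (_ ∷ (b≡b′ ∷ p)) with prepend-prefix w w′ p
  ... | w≡w′ , p′ = cong₂ _∷_ b≡b′ w≡w′ , p′

  drop-code : ∀ k b σ → drop (suc k) (code (b ∷ σ)) ≡ drop k (code σ)
  drop-code k b σ = trans (fold-suc _ tail k) (cong (drop k) (tail-code b σ))

  drop-2*suc : ∀ x b b′ σ → drop (2 * suc x) (code (b ∷ b′ ∷ σ)) ≡ drop (2 * x) (code σ)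
  drop-2*suc x b b′ σ = trans (cong (λ k → drop k (code (b ∷ b′ ∷ σ))) (*-suc 2 x))
    (trans (drop-code (suc (2 * x)) b (b′ ∷ σ)) (drop-code (2 * x) b′ σ))

  drop-0 : ∀ k → drop k 0 ≡ 0
  drop-0 zero    = refl
  drop-0 (suc k) = cong tail (drop-0 k)

  -- Odd codes belong to strings that begin with `false`, so 0 signals the delimiter. The empty
  -- string has the even code 0; past the end of the input the search therefore runs forever.
  stop : ℕ → ℕ → ℕ
  stop x n = 1 ∸ odd (drop (2 * x) n)

  stopᶜ : ComputableOp 2 stop
  stopᶜ = op (app₂ ∸ᶜ (constᶜ 1) (app₁ oddᶜ (app₂ dropᶜ (app₂ *ᶜ (constᶜ 2) (arg 0F)) (arg 1F))))

  stop-true : ∀ σ → stop 0 (code (true ∷ σ)) ≡ 1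
  stop-true σ = cong (λ o → 1 ∸ (1 ∸ o)) (odd-1+2* (code σ))

  stop-false : ∀ σ → stop 0 (code (false ∷ σ)) ≡ 0
  stop-false σ = cong (1 ∸_) (odd-1+2* (code σ))

  stop-suc : ∀ x b b′ σ → stop (suc x) (code (b ∷ b′ ∷ σ)) ≡ stop x (code σ)
  stop-suc x b b′ σ = cong (λ n → 1 ∸ odd n) (drop-2*suc x b b′ σ)

  stop-prepend : ∀ w π → IsLeastZero (λ x → stop x (code (prepend w π))) (length w)
  stop-prepend []      π = (λ _ ()) , stop-false π
  stop-prepend (b ∷ w) π with stop-prepend w π
  ... | below , least =
    (λ { zero    _         → 0 , stop-true (b ∷ prepend w π)
       ; (suc x) (s≤s x<ℓ) → let z , eq = below x x<ℓ in z , trans (stop-suc x true b (prepend w π)) eq }) ,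
    trans (stop-suc (length w) true b (prepend w π)) least

  -- Each unsuccessful test accounts for one pair `true ∷ b` of the input, and an input that runs
  -- out first contradicts the final zero.
  stop-prepend⁻¹ : ∀ ℓ τ → IsLeastZero (λ x → stop x (code τ)) ℓ →
                   ∃₂ λ w π → τ ≡ prepend w π × length w ≡ ℓ
  stop-prepend⁻¹ ℓ       []          (_ , least) with () ← trans (sym (cong (λ n → 1 ∸ odd n) (drop-0 (2 * ℓ)))) least
  stop-prepend⁻¹ zero    (false ∷ σ) _           = [] , σ , refl , refl
  stop-prepend⁻¹ zero    (true ∷ σ)  (_ , least) with () ← trans (sym (stop-true σ)) least
  stop-prepend⁻¹ (suc ℓ) (false ∷ σ) (below , _) with z , eq ← below 0 (s≤s z≤n)
    with () ← trans (sym (stop-false σ)) eq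
  stop-prepend⁻¹ (suc ℓ) (true ∷ []) (_ , least)
    with () ← trans (sym (cong (λ n → 1 ∸ odd n)
                (trans (cong (λ k → drop k 2) (*-suc 2 ℓ)) (trans (drop-code (suc (2 * ℓ)) true []) (drop-0 (suc (2 * ℓ))))))) least
  stop-prepend⁻¹ (suc ℓ) (true ∷ b ∷ σ) (below , least)
    with stop-prepend⁻¹ ℓ σ ((λ x x<ℓ → let z , eq = below (suc x) (s≤s x<ℓ) in
                                z , trans (sym (stop-suc x true b σ)) eq)
                            , trans (sym (stop-suc ℓ true b σ)) least)
  ... | w , π , refl , refl = b ∷ w , π , refl , refl

  drop-prepend : ∀ w π → drop (suc (2 * length w)) (code (prepend w π)) ≡ code π
  drop-prepend []      π = tail-code false π
  drop-prepend (b ∷ w) π = trans (fold-suc _ tail (2 * suc (length w)))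
    (trans (cong (drop (2 * suc (length w))) (tail-code true (b ∷ prepend w π)))
    (trans (cong (λ k → drop k (code (b ∷ prepend w π))) (*-suc 2 (length w)))
    (trans (drop-code (suc (2 * length w)) b (prepend w π)) (drop-prepend w π))))

  at : String → ℕ → Bool
  at []      _       = false
  at (b ∷ w) zero    = b
  at (b ∷ w) (suc i) = at w i

  applyUpTo-at : ∀ w → applyUpTo (at w) (length w) ≡ w
  applyUpTo-at []      = refl
  applyUpTo-at (b ∷ w) = cong (b ∷_) (applyUpTo-at w)

  HasBit-prepend : ∀ w π j → j < length w → HasBit (code (prepend w π)) (1 + 2 * j) (at w j)
  HasBit-prepend (b ∷ w) π zero    _         = trans
    (cong (λ n → 2 ∸ odd n) (tail-code true (b ∷ prepend w π))) (2∸odd-code b (prepend w π))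
  HasBit-prepend (b ∷ w) π (suc j) (s≤s j<ℓ) = trans (cong (λ n → 2 ∸ odd n)
    (trans (cong (λ k → drop k (code (prepend (b ∷ w) π))) (cong suc (*-suc 2 j)))
    (trans (drop-code (suc (suc (2 * j))) true (b ∷ prepend w π)) (drop-code (suc (2 * j)) b (prepend w π)))))
    (HasBit-prepend w π j j<ℓ)

  gather-prepend : ∀ w π → gather (code (prepend w π)) 1 2 (length w) ≡ code w
  gather-prepend w π = trans (gather-code _ 1 2 (length w) (at w) (HasBit-prepend w π)) (cong code (applyUpTo-at w))

  module _ {g : ℕ → ℕ → ℕ} (gᶜ : ComputableOp 2 g) (U : Machine) (U-universal : Universal U) where

    open Universal U-universal

    private

      payloadᶜ : ComputableOp 2 (λ ℓ n → gather n 1 2 ℓ)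
      payloadᶜ = op (app₄ gatherᶜ (arg 1F) (constᶜ 1) (constᶜ 2) (arg 0F))

      restᶜ : ComputableOp 2 (λ ℓ n → drop (suc (2 * ℓ)) n)
      restᶜ = op (app₂ dropᶜ (app₁ sucᶜ (app₂ *ᶜ (constᶜ 2) (arg 0F))) (arg 1F))

      delimiter : Machine
      delimiter = mu (stopᶜ .uncurried .program)

      withDelimiter : ∀ {f} → ComputableOp 2 f → Machine
      withDelimiter (op f) = compose (f .program) (delimiter ∷ proj 0F ∷ [])

      postprocessor : Machine
      postprocessor = compose (gᶜ .uncurried .program)
        (withDelimiter payloadᶜ ∷ compose U (withDelimiter restᶜ ∷ []) ∷ [])

      delimiter↓ : ∀ {F : Fin 0 → ℕ → ℕ} w π → F ⊢ delimiter [ code (prepend w π) ∷ [] ]↓ length w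
      delimiter↓ w π = mu-least (stopᶜ .uncurried) (stop-prepend w π)

      delimiter↓⁻¹ : ∀ {F : Fin 0 → ℕ → ℕ} τ {ℓ} → F ⊢ delimiter [ code τ ∷ [] ]↓ ℓ →
                     ∃₂ λ w π → τ ≡ prepend w π × length w ≡ ℓ
      delimiter↓⁻¹ τ ℓ↓ = stop-prepend⁻¹ _ τ (mu-least⁻¹ (stopᶜ .uncurried) ℓ↓)

      withDelimiter↓ : ∀ {F : Fin 0 → ℕ → ℕ} {f} (fᶜ : ComputableOp 2 f) w π {y} →
                       f (length w) (code (prepend w π)) ≡ y →
                       F ⊢ withDelimiter fᶜ [ code (prepend w π) ∷ [] ]↓ y
      withDelimiter↓ (op f) w π refl = compose↓ (delimiter↓ w π ∷ proj↓ ∷ []) (f .computes _)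

      postprocessor↓ : ∀ w π {σ σ′} → U ⟨ π ⟩≃ σ → code σ′ ≡ g (code w) (code σ) →
                       postprocessor ⟨ prepend w π ⟩≃ σ′
      postprocessor↓ w π U↓ eq = subst ((λ ()) ⊢ postprocessor [ _ ]↓_) (sym eq) (compose↓
        (withDelimiter↓ payloadᶜ w π (gather-prepend w π) ∷
         compose↓ (withDelimiter↓ restᶜ w π (drop-prepend w π) ∷ []) U↓ ∷ [])
        (gᶜ .uncurried .computes _))

      -- Composition is strict, so convergence forces both the delimiter search and `U` to converge.
      -- The derivation gives the output of `U` as a bare number; `decode` supplies the string that
      -- `∈dom` asks for.
      postprocessor-domain : ∀ τ → τ ∈dom postprocessor → ∃₂ λ w π → τ ≡ prepend w π × π ∈dom U
      postprocessor-domain τ (_ , compose↓ {ys = _ ∷ s ∷ []} (compose↓ (ℓ↓ ∷ _) _ ∷ compose↓ (rest↓ ∷ []) U↓ ∷ []) _)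
        with delimiter↓⁻¹ τ ℓ↓
      ... | w , π , refl , refl with deterministic rest↓ (withDelimiter↓ restᶜ w π refl)
      ...   | refl with decode s
      ...     | σ , refl = w , π , refl , σ , subst (λ n → (λ ()) ⊢ U [ n ∷ [] ]↓ code σ) (drop-prepend w π) U↓

      -- The payload is self-delimiting: comparable programs carry the same payload, and
      -- comparability passes to the remaining programs of `U`.
      postprocessor-prefixFree : PrefixFree postprocessor
      postprocessor-prefixFree τ τ′ τ∈ τ′∈ τ⊑τ′ with postprocessor-domain τ τ∈ | postprocessor-domain τ′ τ′∈
      ... | w , π , refl , π∈ | w′ , π′ , refl , π′∈ with prepend-prefix w w′ τ⊑τ′
      ...   | w≡w′ , π⊑π′ = cong₂ prepend w≡w′ (prefixFree π π′ π∈ π′∈ π⊑π′)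

    abstract

      -- The payload counts twice because every bit of it follows a marker bit; `c` covers the
      -- simulation prefix and the delimiter.
      postprocess : ∃[ c ] (∀ w π {σ σ′} → U ⟨ π ⟩≃ σ → code σ′ ≡ g (code w) (code σ) →
                      ∃[ θ ] (length θ ≡ c + 2 * length w + length π × U ⟨ θ ⟩≃ σ′))
      postprocess with simulates postprocessor postprocessor-prefixFree
      ... | ρ , simulates-postprocessor = suc (length ρ) , λ w π {σ} {σ′} U↓ eq →
        ρ ++ prepend w π ,
        trans (length-++ ρ) (trans (cong (length ρ +_) (length-prepend w π))
          (trans (+-suc (length ρ) _) (cong suc (sym (+-assoc (length ρ) _ _))))) ,
        Equivalence.from (simulates-postprocessor (prepend w π) σ′) (postprocessor↓ w π {σ} {σ′} U↓ eq)

  -- K is not computable, so a least program exists only under double negation.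
  IsK-exists : ∀ U {σ} θ → U ⟨ θ ⟩≃ σ → ¬ ¬ (∃[ k ] (k ≤ length θ × IsK U σ k))
  IsK-exists U {σ} θ U↓ none = <-rec Unused step (length θ) θ refl U↓ ≤-refl
    where
    Unused : ℕ → Set
    Unused n = ∀ π → length π ≡ n → U ⟨ π ⟩≃ σ → ¬ (n ≤ length θ)
    step : ∀ n → (∀ {m} → m < n → Unused m) → Unused n
    step n shorter π refl π↓ n≤ = none (n , n≤ , (π , refl , π↓) ,
      λ π′ π′↓ → ≮⇒≥ λ π′<π → shorter π′<π π′ refl π′↓ (≤-trans (<⇒≤ π′<π) n≤))

-- The Toeplitz sequence

module _ where

  open import Data.Nat.Base
  open import Data.Nat.Properties

  -- unpair₁ i is the level t of position i and unpair₂ i its rank within the level; the low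
  -- D (1 + t) digits of the rank select the stream k, the high ones are taken modulo 2 ^ k.
  index : ℕ → ℕ → ℕ
  index D i = low (low (D * suc (unpair₁ i)) (unpair₂ i)) (high (D * suc (unpair₁ i)) (unpair₂ i))

  indexᶜ : ∀ D → ComputableOp 1 (index D)
  indexᶜ D = op (app₂ lowᶜ (app₂ lowᶜ block rank) (app₂ highᶜ block rank))
    where
    block = app₂ *ᶜ (constᶜ D) (app₁ sucᶜ (app₁ unpair₁ᶜ (arg 0F)))
    rank  = app₁ unpair₂ᶜ (arg 0F)

  index-pair : ∀ D t {k} j q → k < 2 ^ (D * suc t) → j < 2 ^ k →
               index D (pair t (k + 2 ^ (D * suc t) * (j + 2 ^ k * q))) ≡ j
  index-pair D t {k} j q k< j< = begin
    index D i                                    ≡⟨ cong₂ (λ t y → low (low (D * suc t) y) (high (D * suc t) y))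
                                                      (unpair₁-pair t rank) (unpair₂-pair t rank) ⟩
    low (low (D * suc t) rank) (high (D * suc t) rank)
                                                 ≡⟨ cong₂ low (low-+* (D * suc t) (j + 2 ^ k * q) k<)
                                                              (high-+* (D * suc t) (j + 2 ^ k * q) k<) ⟩
    low k (j + 2 ^ k * q)                        ≡⟨ low-+* k q j< ⟩
    j                                            ∎
    where
    open ≡-Reasoning
    rank = k + 2 ^ (D * suc t) * (j + 2 ^ k * q)
    i = pair t rank

  -- v = pair k (pair e i) stands for the first 2 ^ k terms of the progression i, i + 2 ^ e, …
  extract : ℕ → ℕ → ℕ
  extract v n = gather n (unpair₂ (unpair₂ v)) (2 ^ unpair₁ (unpair₂ v)) (2 ^ unpair₁ v)

  extractᶜ : ComputableOp 2 extract
  extractᶜ = op (app₄ gatherᶜ (arg 1F) (app₁ unpair₂ᶜ (app₁ unpair₂ᶜ (arg 0F)))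
    (app₁ 2^ᶜ (app₁ unpair₁ᶜ (app₁ unpair₂ᶜ (arg 0F)))) (app₁ 2^ᶜ (app₁ unpair₁ᶜ (arg 0F))))

  extract-pair : ∀ k e i n → extract (pair k (pair e i)) n ≡ gather n i (2 ^ e) (2 ^ k)
  extract-pair k e i n = trans
    (cong₂ (λ k v → gather n (unpair₂ v) (2 ^ unpair₁ v) (2 ^ k))
      (unpair₁-pair k (pair e i)) (unpair₂-pair k (pair e i)))
    (cong₂ (λ e i → gather n i (2 ^ e) (2 ^ k)) (unpair₁-pair e i) (unpair₂-pair e i))

  -- Finds the first place at or after `s` where a copy begins. Moving `s` one step shortens the
  -- wait by one, or resets it to `l - 1` when it was zero.
  next-multiple : ∀ {r l} → r < l → ∀ s → ∃₂ λ q i → s + i ≡ r + l * q × i < l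
  next-multiple {r} {l} r<l zero    = 0 , r , sym (trans (cong (r +_) (*-zeroʳ l)) (+-identityʳ r)) , r<l
  next-multiple {r} {l} r<l (suc s) with next-multiple r<l s
  ... | q , suc i , eq , i<l = q , i , trans (sym (+-suc s i)) eq , <⇒≤ i<l
  ... | q , zero  , eq , (s≤s {n = l-1} _) = suc q , l-1 , eq′ , ≤-refl
    where
    open ≡-Reasoning
    eq′ : suc (s + l-1) ≡ r + l * suc q
    eq′ = begin
      suc (s + l-1)      ≡⟨ +-suc s l-1 ⟨
      s + l              ≡⟨ cong (_+ l) (trans (sym (+-identityʳ s)) eq) ⟩
      r + l * q + l      ≡⟨ +-assoc r (l * q) l ⟩
      r + (l * q + l)    ≡⟨ cong (r +_) (trans (+-comm (l * q) l) (sym (*-suc l q))) ⟩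
      r + l * suc q      ∎

  module Toeplitz (D t K : ℕ) (K< : K < 2 ^ (D * suc t)) where

    e : ℕ
    e = suc t + D * suc t

    private

      2^e* : ∀ x → 2 ^ suc t * (2 ^ (D * suc t) * x) ≡ 2 ^ e * x
      2^e* x = trans (sym (*-assoc (2 ^ suc t) _ x)) (cong (_* x) (sym (^-distribˡ-+-* 2 (suc t) (D * suc t))))

      residue : ℕ
      residue = pair t K

      residue< : residue < 2 ^ e * 2 ^ K
      residue< = begin-strict
        pair t K                          <⟨ pair< t K< ⟩
        2 ^ suc t * 2 ^ (D * suc t)       ≡⟨ ^-distribˡ-+-* 2 (suc t) (D * suc t) ⟨
        2 ^ e                             ≡⟨ *-identityʳ _ ⟨
        2 ^ e * 1                         ≤⟨ *-monoʳ-≤ (2 ^ e) (m^n>0 2 K) ⟩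
        2 ^ e * 2 ^ K                     ∎
        where open ≤-Reasoning

      index-residue : ∀ j q → j < 2 ^ K → index D (residue + 2 ^ e * 2 ^ K * q + 2 ^ e * j) ≡ j
      index-residue j q j< = trans (cong (index D) (begin
        residue + 2 ^ e * 2 ^ K * q + 2 ^ e * j          ≡⟨ +-assoc residue _ _ ⟩
        residue + (2 ^ e * 2 ^ K * q + 2 ^ e * j)        ≡⟨ cong (λ x → residue + (x + 2 ^ e * j)) (*-assoc (2 ^ e) _ q) ⟩
        residue + (2 ^ e * (2 ^ K * q) + 2 ^ e * j)      ≡⟨ cong (residue +_) (*-distribˡ-+ (2 ^ e) _ j) ⟨
        residue + 2 ^ e * (2 ^ K * q + j)                ≡⟨ cong (λ x → residue + 2 ^ e * x) (+-comm (2 ^ K * q) j) ⟩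
        residue + 2 ^ e * (j + 2 ^ K * q)                ≡⟨ cong (residue +_) (2^e* _) ⟨
        residue + 2 ^ suc t * (2 ^ (D * suc t) * (j + 2 ^ K * q))
                                                         ≡⟨ pair-+* t K _ ⟨
        pair t (K + 2 ^ (D * suc t) * (j + 2 ^ K * q))   ∎)) (index-pair D t j q K< j<)
        where open ≡-Reasoning

    -- One copy of `X ↾ (2 ^ K)` spreads over `2 ^ e * 2 ^ K` positions. The first copy to start in
    -- the window starts within one such period and ends within the next, hence the factor 2.
    substring-extract : ∀ (X : ℕ → Bool) s n → 2 * (2 ^ e * 2 ^ K) ≤ n →
      ∃[ i ] (i < 2 ^ e * 2 ^ K ×
              code (X ↾ (2 ^ K)) ≡ extract (pair K (pair e i)) (code (substring (X ∘ index D) s n)))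
    substring-extract X s n n≥ with next-multiple residue< s
    ... | q , i , eq , i< = i , i< , sym (trans (extract-pair K e i _)
        (gather-code _ i (2 ^ e) (2 ^ K) X λ j j< →
          subst (HasBit _ (i + 2 ^ e * j)) (cong X (index≡ j j<)) (HasBit-applyUpTo _ n _ (bound j j<))))
      where
      index≡ : ∀ j → j < 2 ^ K → index D (s + (i + 2 ^ e * j)) ≡ j
      index≡ j j< = trans (cong (index D) (trans (sym (+-assoc s i _)) (cong (_+ 2 ^ e * j) eq)))
        (index-residue j q j<)
      bound : ∀ j → j < 2 ^ K → i + 2 ^ e * j < n
      bound j j< = ≤-trans (+-mono-<-≤ i< (*-monoʳ-≤ (2 ^ e) (<⇒≤ j<)))
        (≤-trans (+-monoʳ-≤ (2 ^ e * 2 ^ K) (≤-reflexive (sym (+-identityʳ _)))) n≥)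

    -- The unary parts take `suc K` and `suc e` digits, the offset `e + K`.
    pair<2^ : ∀ {i} → i < 2 ^ e * 2 ^ K → pair K (pair e i) < 2 ^ (2 * suc (K + e))
    pair<2^ {i} i< = begin-strict
      pair K (pair e i)                        <⟨ pair< K (pair< e i<) ⟩
      2 ^ suc K * (2 ^ suc e * (2 ^ e * 2 ^ K)) ≡⟨ cong (λ x → 2 ^ suc K * (2 ^ suc e * x)) (^-distribˡ-+-* 2 e K) ⟨
      2 ^ suc K * (2 ^ suc e * 2 ^ (e + K))    ≡⟨ cong (2 ^ suc K *_) (^-distribˡ-+-* 2 (suc e) (e + K)) ⟨
      2 ^ suc K * 2 ^ (suc e + (e + K))        ≡⟨ ^-distribˡ-+-* 2 (suc K) (suc e + (e + K)) ⟨
      2 ^ (suc K + (suc e + (e + K)))          ≡⟨ cong (2 ^_) (solve 2 (λ K e →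
                                                    con 1 :+ K :+ (con 1 :+ e :+ (e :+ K)) :=
                                                    con 2 :* (con 1 :+ (K :+ e))) refl K e) ⟩
      2 ^ (2 * suc (K + e))                    ∎
      where
      open ≤-Reasoning
      open +-*-Solver

  abstract

    substring-computes-prefix : ∀ U → Universal U → ∃[ c ] (∀ D t K X s n → let e = suc t + D * suc t in
      K < 2 ^ (D * suc t) → 2 * (2 ^ e * 2 ^ K) ≤ n →
      ∀ π → U ⟨ π ⟩≃ substring (X ∘ index D) s n →
      ∃[ θ ] (length θ ≤ c + 4 * suc (K + e) + length π × U ⟨ θ ⟩≃ (X ↾ (2 ^ K))))
    substring-computes-prefix U U-universal with postprocess extractᶜ U U-universal
    ... | c , computes = c , λ D t K X s n K< n≥ π U↓ →
      let open Toeplitz D t K K<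
          i , i< , eq = substring-extract X s n n≥
          w , w≡ = decode (pair K (pair e i))
          θ , θ≡ , θ↓ = computes w π {substring (X ∘ index D) s n} {X ↾ (2 ^ K)} U↓ (trans eq (cong (λ v → extract v _) (sym w≡)))
          -- `postprocess` charges the payload twice, which makes the factor 4 in the bound on `θ`.
          w≤ : length w ≤ 2 * suc (K + e)
          w≤ = 2^-cancel-≤ (≤-trans (2^length≤1+code w) (subst (_< 2 ^ (2 * suc (K + e))) (sym w≡) (pair<2^ i<)))
      in θ , ≤-trans (≤-reflexive θ≡) (+-monoˡ-≤ (length π) (+-monoʳ-≤ c
               (≤-trans (*-monoʳ-≤ 2 w≤) (≤-reflexive (sym (*-assoc 2 2 (suc (K + e)))))))) , θ↓

-- Growth

module _ where

  open import Data.Nat.Base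
  open import Data.Nat.Properties

  ^-distribʳ-* : ∀ m n o → (n * o) ^ m ≡ n ^ m * o ^ m
  ^-distribʳ-* zero    n o = refl
  ^-distribʳ-* (suc m) n o = trans (cong (n * o *_) (^-distribʳ-* m n o))
    (solve 4 (λ n o x y → n :* o :* (x :* y) := n :* x :* (o :* y)) refl n o (n ^ m) (o ^ m))
    where open +-*-Solver

  module _ where
    open ≤-Reasoning
    open +-*-Solver

    -- Induction on the degree by halving: with `j = half K`, one factor of `K` is paid for by
    -- `suc j ≤ 2 ^ j`, and the rest, at most `(3 * j) ^ a` with its constants, by the induction
    -- hypothesis at `j`.
    polynomial≤2^ : ∀ a c → ∃[ K₀ ] (∀ K → K₀ ≤ K → c * K ^ a ≤ 2 ^ K)
    polynomial≤2^ zero    c = c , λ K c≤K → begin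
      c * 1   ≡⟨ *-identityʳ c ⟩
      c       ≤⟨ c≤K ⟩
      K       ≤⟨ <⇒≤ (n<2^n K) ⟩
      2 ^ K   ∎
    polynomial≤2^ (suc a) c with polynomial≤2^ a (c * 3 ^ a * 2)
    ... | J , bound = 2 + 2 * J , λ K K₀≤K →
      let j = half K
          K≤ : K ≤ 1 + 2 * j
          K≤ = subst (_≤ 1 + 2 * j) (odd+2*half K) (+-monoˡ-≤ (2 * j) (odd≤1 K))
          J<j : J < j
          J<j = *-cancelˡ-< 2 J j (≤-pred (≤-trans K₀≤K K≤))
          2j≤K : 2 * j ≤ K
          2j≤K = subst (2 * j ≤_) (odd+2*half K) (m≤n+m _ (odd K))
          K≤3j : K ≤ 3 * j
          K≤3j = ≤-trans K≤ (+-monoˡ-≤ (2 * j) (≤-trans (s≤s z≤n) J<j))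
      in begin
      c * (K * K ^ a)                        ≤⟨ *-monoʳ-≤ c (*-mono-≤ (≤-trans K≤ (n≤1+n _)) (^-monoˡ-≤ a K≤3j)) ⟩
      c * ((2 + 2 * j) * (3 * j) ^ a)        ≡⟨ cong (λ x → c * ((2 + 2 * j) * x)) (^-distribʳ-* a 3 j) ⟩
      c * ((2 + 2 * j) * (3 ^ a * j ^ a))    ≡⟨ solve 4 (λ c j x y → c :* ((con 2 :+ con 2 :* j) :* (x :* y)) :=
                                                  c :* x :* con 2 :* y :* (con 1 :+ j)) refl c j (3 ^ a) (j ^ a) ⟩
      c * 3 ^ a * 2 * j ^ a * suc j          ≤⟨ *-mono-≤ (bound j (<⇒≤ J<j)) (n<2^n j) ⟩
      2 ^ j * 2 ^ j                          ≡⟨ ^-distribˡ-+-* 2 j j ⟨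
      2 ^ (j + j)                            ≤⟨ ^-monoʳ-≤ 2 (subst (_≤ K) (cong (j +_) (+-identityʳ j)) 2j≤K) ⟩
      2 ^ K                                  ∎

  module Growth (p₁ p₂ d₁ d₂ r : ℕ) .{{_ : NonZero d₁}} .{{_ : NonZero d₂}}
                (p₁d₂+d₁d₂<rd₁+p₂d₂ : p₁ * d₂ + d₁ * d₂ < r * d₁ + p₂ * d₂) where

    -- D exceeds the inverse of β - α - 1 ≥ 1 / (d₁ d₂), where α = (p₁ - p₂) / d₁ and β = r / d₂.
    D T S A B R : ℕ
    D = suc (d₁ * d₂)
    T = d₁ * d₂ * D
    S = suc D * (d₁ * d₂)
    A = p₁ * d₂ * D
    B = p₂ * d₂ * D
    R = r * d₁ * D

    private

      -- Over the common denominator `T`, the numbers `A - B`, `S` and `R` stand for `α`, `1 + 1/D`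
      -- and `β`. The gap `β - α - 1` is at least `D` units of `1/T`; `1/D` uses `d₁ * d₂ = D - 1`
      -- of them, and the last one becomes the spare factor `K` below.
      exponents : A + S + 1 ≤ R + B
      exponents = begin
        A + S + 1                                       ≡⟨ solve 2 (λ x d → let D = con 1 :+ d in
                                                             x :* D :+ (con 1 :+ D) :* d :+ con 1 :=
                                                             (con 1 :+ (x :+ d)) :* D) refl (p₁ * d₂) (d₁ * d₂) ⟩
        suc (p₁ * d₂ + d₁ * d₂) * D                     ≤⟨ *-monoˡ-≤ D p₁d₂+d₁d₂<rd₁+p₂d₂ ⟩
        (r * d₁ + p₂ * d₂) * D                          ≡⟨ *-distribʳ-+ D (r * d₁) (p₂ * d₂) ⟩
        R + B                                           ∎
        where
        open ≤-Reasoning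
        open +-*-Solver

      c₄ c₅ : ℕ
      c₄ = 2 ^ (2 * T + S + D * S)
      c₅ = 2 ^ B * 2 ^ A

    module _ (K : ℕ) (1≤K : 1 ≤ K) where

      private instance
        K≢0 : NonZero K
        K≢0 = >-nonZero 1≤K

      -- The hypothesis `k ≤ 2^E / E^β` is raised to the power `T`. Here `E ≥ K`, while `2^E` is at
      -- most a constant times `2^K * K^(1+1/D)`. The resulting factor `K ^ S` is put on both sides
      -- and cancelled, which avoids negative exponents.
      upper-bound : ∀ k t → let E = suc D * suc t + (2 + K) in
                    2 ^ (D * t) ≤ suc K → k ^ d₂ * E ^ r ≤ (2 ^ E) ^ d₂ →
                    k ^ T * K ^ A * K ≤ c₄ * (2 ^ (K * T) * K ^ B)
      upper-bound k t 2^Dt≤ le = *-cancelʳ-≤ _ _ (K ^ S) {{m^n≢0 K S}} (begin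
        k ^ T * K ^ A * K * K ^ S          ≡⟨ solve 4 (λ x y z w → x :* y :* z :* w := x :* (y :* w :* (z :* con 1)))
                                                refl (k ^ T) (K ^ A) K (K ^ S) ⟩
        k ^ T * (K ^ A * K ^ S * K ^ 1)    ≡⟨ cong (k ^ T *_) (cong (_* K ^ 1) (^-distribˡ-+-* K A S)) ⟨
        k ^ T * (K ^ (A + S) * K ^ 1)      ≡⟨ cong (k ^ T *_) (^-distribˡ-+-* K (A + S) 1) ⟨
        k ^ T * K ^ (A + S + 1)            ≤⟨ *-monoʳ-≤ (k ^ T) (^-monoʳ-≤ K exponents) ⟩
        k ^ T * K ^ (R + B)                ≡⟨ cong (k ^ T *_) (^-distribˡ-+-* K R B) ⟩
        k ^ T * (K ^ R * K ^ B)            ≡⟨ *-assoc (k ^ T) (K ^ R) (K ^ B) ⟨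
        k ^ T * K ^ R * K ^ B              ≤⟨ *-monoˡ-≤ (K ^ B) raised ⟩
        2 ^ (E * T) * K ^ B                ≤⟨ *-monoˡ-≤ (K ^ B) 2^ET≤ ⟩
        2 ^ (K * T) * (c₄ * K ^ S) * K ^ B ≡⟨ solve 4 (λ x c s b → x :* (c :* s) :* b := c :* (x :* b) :* s)
                                                refl (2 ^ (K * T)) c₄ (K ^ S) (K ^ B) ⟩
        c₄ * (2 ^ (K * T) * K ^ B) * K ^ S ∎)
        where
        open ≤-Reasoning
        open +-*-Solver
        E = suc D * suc t + (2 + K)
        d₂*d₁D : d₂ * (d₁ * D) ≡ T
        d₂*d₁D = solve 3 (λ x y z → x :* (y :* z) := y :* x :* z) refl d₂ d₁ D
        raised : k ^ T * K ^ R ≤ 2 ^ (E * T)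
        raised = begin
          k ^ T * K ^ R                               ≤⟨ *-monoʳ-≤ (k ^ T) (^-monoˡ-≤ R (≤-trans (m≤n+m K 2) (m≤n+m (2 + K) (suc D * suc t)))) ⟩
          k ^ T * E ^ R                               ≡⟨ cong₂ (λ x y → k ^ x * E ^ y) d₂*d₁D (sym (*-assoc r d₁ D)) ⟨
          k ^ (d₂ * (d₁ * D)) * E ^ (r * (d₁ * D))    ≡⟨ cong₂ _*_ (^-*-assoc k d₂ (d₁ * D)) (^-*-assoc E r (d₁ * D)) ⟨
          (k ^ d₂) ^ (d₁ * D) * (E ^ r) ^ (d₁ * D)    ≡⟨ ^-distribʳ-* (d₁ * D) (k ^ d₂) (E ^ r) ⟨
          (k ^ d₂ * E ^ r) ^ (d₁ * D)                 ≤⟨ ^-monoˡ-≤ (d₁ * D) le ⟩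
          ((2 ^ E) ^ d₂) ^ (d₁ * D)                   ≡⟨ ^-*-assoc (2 ^ E) d₂ (d₁ * D) ⟩
          (2 ^ E) ^ (d₂ * (d₁ * D))                   ≡⟨ cong ((2 ^ E) ^_) d₂*d₁D ⟩
          (2 ^ E) ^ T                                 ≡⟨ ^-*-assoc 2 E T ⟩
          2 ^ (E * T)                                 ∎
        2^ET≤ : 2 ^ (E * T) ≤ 2 ^ (K * T) * (c₄ * K ^ S)
        2^ET≤ = begin
          2 ^ (E * T)
            ≡⟨ cong (2 ^_) (solve 3 (λ d t K → let D = con 1 :+ d ; T = d :* D ; S = (con 1 :+ D) :* d in
                 ((con 1 :+ D) :* (con 1 :+ t) :+ (con 2 :+ K)) :* T :=
                 K :* T :+ ((con 2 :* T :+ D :* S) :+ D :* t :* S)) refl (d₁ * d₂) t K) ⟩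
          2 ^ (K * T + ((2 * T + D * S) + D * t * S))
            ≡⟨ trans (^-distribˡ-+-* 2 (K * T) _) (cong (2 ^ (K * T) *_)
                 (trans (^-distribˡ-+-* 2 (2 * T + D * S) (D * t * S)) (cong (2 ^ (2 * T + D * S) *_) (sym (^-*-assoc 2 (D * t) S))))) ⟩
          2 ^ (K * T) * (2 ^ (2 * T + D * S) * (2 ^ (D * t)) ^ S)
            ≤⟨ *-monoʳ-≤ (2 ^ (K * T)) (*-monoʳ-≤ (2 ^ (2 * T + D * S)) (^-monoˡ-≤ S (≤-trans 2^Dt≤ (1+n≤2*n 1≤K)))) ⟩
          2 ^ (K * T) * (2 ^ (2 * T + D * S) * (2 * K) ^ S)
            ≡⟨ cong (λ x → 2 ^ (K * T) * (2 ^ (2 * T + D * S) * x)) (^-distribʳ-* S 2 K) ⟩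
          2 ^ (K * T) * (2 ^ (2 * T + D * S) * (2 ^ S * K ^ S))
            ≡⟨ cong (2 ^ (K * T) *_) (*-assoc (2 ^ (2 * T + D * S)) (2 ^ S) (K ^ S)) ⟨
          2 ^ (K * T) * (2 ^ (2 * T + D * S) * 2 ^ S * K ^ S)
            ≡⟨ cong (λ x → 2 ^ (K * T) * (x * K ^ S)) (trans (sym (^-distribˡ-+-* 2 (2 * T + D * S) S))
                 (cong (2 ^_) (solve 3 (λ x y z → x :+ y :+ z := x :+ z :+ y) refl (2 * T) (D * S) S))) ⟩
          2 ^ (K * T) * (c₄ * K ^ S) ∎

      -- Puts `Z ≥ 2^K / K^α` over the same denominator `T`. Replacing `pred K` and `suc K` by `K`
      -- costs only the powers of two in `c₅`.
      lower-bound : ∀ Z → (2 ^ K) ^ d₁ * pred K ^ p₂ ≤ suc K ^ p₁ * Z ^ d₁ → 2 ≤ K →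
                    2 ^ (K * T) * K ^ B ≤ c₅ * (K ^ A * Z ^ T)
      lower-bound Z le 2≤K = begin
        2 ^ (K * T) * K ^ B                   ≤⟨ *-monoʳ-≤ (2 ^ (K * T)) (^-monoˡ-≤ B K≤2pred) ⟩
        2 ^ (K * T) * (2 * pred K) ^ B        ≡⟨ cong (2 ^ (K * T) *_) (^-distribʳ-* B 2 (pred K)) ⟩
        2 ^ (K * T) * (2 ^ B * pred K ^ B)    ≡⟨ solve 3 (λ x y z → x :* (y :* z) := y :* (x :* z)) refl (2 ^ (K * T)) (2 ^ B) (pred K ^ B) ⟩
        2 ^ B * (2 ^ (K * T) * pred K ^ B)    ≤⟨ *-monoʳ-≤ (2 ^ B) raised ⟩
        2 ^ B * (suc K ^ A * Z ^ T)           ≤⟨ *-monoʳ-≤ (2 ^ B) (*-monoˡ-≤ (Z ^ T) (^-monoˡ-≤ A (1+n≤2*n 1≤K))) ⟩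
        2 ^ B * ((2 * K) ^ A * Z ^ T)         ≡⟨ cong (λ x → 2 ^ B * (x * Z ^ T)) (^-distribʳ-* A 2 K) ⟩
        2 ^ B * (2 ^ A * K ^ A * Z ^ T)       ≡⟨ solve 4 (λ x y z w → x :* (y :* z :* w) := x :* y :* (z :* w)) refl (2 ^ B) (2 ^ A) (K ^ A) (Z ^ T) ⟩
        c₅ * (K ^ A * Z ^ T)                  ∎
        where
        open ≤-Reasoning
        open +-*-Solver
        K≤2pred : K ≤ 2 * pred K
        K≤2pred = subst (_≤ 2 * pred K) (suc-pred K)
          (≤-trans (+-monoˡ-≤ (pred K) (pred-mono-≤ 2≤K)) (+-monoʳ-≤ (pred K) (m≤m+n (pred K) 0)))
        raised : 2 ^ (K * T) * pred K ^ B ≤ suc K ^ A * Z ^ T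
        raised = begin
          2 ^ (K * T) * pred K ^ B                        ≡⟨ cong₂ _*_ eq (sym (power (pred K) p₂)) ⟩
          ((2 ^ K) ^ d₁) ^ (d₂ * D) * (pred K ^ p₂) ^ (d₂ * D) ≡⟨ ^-distribʳ-* (d₂ * D) ((2 ^ K) ^ d₁) (pred K ^ p₂) ⟨
          ((2 ^ K) ^ d₁ * pred K ^ p₂) ^ (d₂ * D)         ≤⟨ ^-monoˡ-≤ (d₂ * D) le ⟩
          (suc K ^ p₁ * Z ^ d₁) ^ (d₂ * D)                ≡⟨ ^-distribʳ-* (d₂ * D) (suc K ^ p₁) (Z ^ d₁) ⟩
          (suc K ^ p₁) ^ (d₂ * D) * (Z ^ d₁) ^ (d₂ * D)   ≡⟨ cong₂ _*_ (power (suc K) p₁) (power Z d₁) ⟩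
          suc K ^ A * Z ^ T                               ∎
          where
          power : ∀ x p → (x ^ p) ^ (d₂ * D) ≡ x ^ (p * d₂ * D)
          power x p = trans (^-*-assoc x p (d₂ * D)) (cong (x ^_) (sym (*-assoc p d₂ D)))
          eq : 2 ^ (K * T) ≡ ((2 ^ K) ^ d₁) ^ (d₂ * D)
          eq = trans (sym (^-*-assoc 2 K T)) (sym (power (2 ^ K) d₁))

    abstract

      -- Read k as K(τ) for a string τ of length at most 2 ^ E, and Z as four times the bound on
      -- K(X ↾ 2 ^ K) that τ gives.
      gap : ∀ c → ∃[ K₀ ] (2 ≤ K₀ × (∀ K → K₀ ≤ K → ∀ k t Z → let E = suc D * suc t + (2 + K) in
              2 ^ (D * t) ≤ suc K → Z ≤ 4 * k + c * K → k ^ d₂ * E ^ r ≤ (2 ^ E) ^ d₂ →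
              suc K ^ p₁ * Z ^ d₁ ≤ (2 ^ K) ^ d₁ * pred K ^ p₂))
      gap c with polynomial≤2^ (A + T) (suc (c₅ * (2 * c) ^ T))
      -- `K₁` serves the case where the overhead dominates `Z`, `c₆` the case where `k` does, and 2
      -- gives `K ≤ 2 * pred K`.
      ... | K₁ , exponential = K₁ + (2 + c₆) , ≤-trans (s≤s (s≤s z≤n)) (m≤n+m (2 + c₆) K₁) , λ K K₀≤K k t Z 2^Dt≤ Z≤ le →
        ≮⇒≥ λ lt → contradiction K K₀≤K k t Z 2^Dt≤ Z≤ le lt
        where
        c₆ : ℕ
        c₆ = c₅ * 8 ^ T * c₄
        contradiction : ∀ K → K₁ + (2 + c₆) ≤ K → ∀ k t Z → let E = suc D * suc t + (2 + K) in
              2 ^ (D * t) ≤ suc K → Z ≤ 4 * k + c * K → k ^ d₂ * E ^ r ≤ (2 ^ E) ^ d₂ →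
              ¬ ((2 ^ K) ^ d₁ * pred K ^ p₂ < suc K ^ p₁ * Z ^ d₁)
        -- If `4 * k` dominates, the two bounds differ by the spare factor `K`, which would then be
        -- at most `c₆`. Otherwise `Z` is linear in `K`, and an exponential would be bounded by a
        -- polynomial.
        contradiction K K₀≤K k t Z 2^Dt≤ Z≤ le lt with ≤-total (c * K) (4 * k)
        ... | inj₁ cK≤4k = <⇒≱ (≤-trans (s≤s (m≤n+m c₆ 1)) (≤-trans (m≤n+m (2 + c₆) K₁) K₀≤K)) K≤c₆
          where
          open ≤-Reasoning
          open +-*-Solver
          instance
            K≢0 : NonZero K
            K≢0 = >-nonZero (≤-trans (s≤s z≤n) (≤-trans (m≤n+m (2 + c₆) K₁) K₀≤K))
          2≤K : 2 ≤ K
          2≤K = ≤-trans (s≤s (s≤s z≤n)) (≤-trans (m≤n+m (2 + c₆) K₁) K₀≤K)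
          Z≤8k : Z ≤ 8 * k
          Z≤8k = ≤-trans Z≤ (≤-trans (+-monoʳ-≤ (4 * k) cK≤4k) (≤-reflexive (sym (*-distribʳ-+ k 4 4))))
          x : ℕ
          x = 2 ^ (K * T) * K ^ B
          K≤c₆ : K ≤ c₆
          K≤c₆ = *-cancelʳ-≤ K c₆ x {{m*n≢0 _ _ {{m^n≢0 2 (K * T)}} {{m^n≢0 K B}}}} (begin
            K * x                                  ≤⟨ *-monoʳ-≤ K (lower-bound K (<⇒≤ 2≤K) Z (<⇒≤ lt) 2≤K) ⟩
            K * (c₅ * (K ^ A * Z ^ T))             ≤⟨ *-monoʳ-≤ K (*-monoʳ-≤ c₅ (*-monoʳ-≤ (K ^ A) (^-monoˡ-≤ T Z≤8k))) ⟩
            K * (c₅ * (K ^ A * (8 * k) ^ T))       ≡⟨ cong (λ y → K * (c₅ * (K ^ A * y))) (^-distribʳ-* T 8 k) ⟩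
            K * (c₅ * (K ^ A * (8 ^ T * k ^ T)))   ≡⟨ solve 5 (λ K c a e k → K :* (c :* (a :* (e :* k))) :=
                                                        c :* e :* (k :* a :* K)) refl K c₅ (K ^ A) (8 ^ T) (k ^ T) ⟩
            c₅ * 8 ^ T * (k ^ T * K ^ A * K)       ≤⟨ *-monoʳ-≤ (c₅ * 8 ^ T) (upper-bound K (<⇒≤ 2≤K) k t 2^Dt≤ le) ⟩
            c₅ * 8 ^ T * (c₄ * x)                  ≡⟨ *-assoc (c₅ * 8 ^ T) c₄ x ⟨
            c₆ * x                                 ∎)
        ... | inj₂ 4k≤cK = <-irrefl refl (begin-strict
            c₇ * K ^ (A + T)                       <⟨ m<n+m (c₇ * K ^ (A + T)) (m^n>0 K (A + T)) ⟩
            suc c₇ * K ^ (A + T)                   ≤⟨ exponential K (≤-trans (m≤m+n K₁ (2 + c₆)) K₀≤K) ⟩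
            2 ^ K                                  ≡⟨ cong (2 ^_) (*-identityʳ K) ⟨
            2 ^ (K * 1)                            ≤⟨ ^-monoʳ-≤ 2 (*-monoʳ-≤ K 1≤T) ⟩
            2 ^ (K * T)                            ≡⟨ *-identityʳ _ ⟨
            2 ^ (K * T) * 1                        ≤⟨ *-monoʳ-≤ (2 ^ (K * T)) (m^n>0 K B) ⟩
            2 ^ (K * T) * K ^ B                    ≤⟨ lower-bound K (<⇒≤ 2≤K) Z (<⇒≤ lt) 2≤K ⟩
            c₅ * (K ^ A * Z ^ T)                   ≤⟨ *-monoʳ-≤ c₅ (*-monoʳ-≤ (K ^ A) (^-monoˡ-≤ T Z≤2cK)) ⟩
            c₅ * (K ^ A * (2 * c * K) ^ T)         ≡⟨ cong (λ y → c₅ * (K ^ A * y)) (^-distribʳ-* T (2 * c) K) ⟩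
            c₅ * (K ^ A * ((2 * c) ^ T * K ^ T))   ≡⟨ solve 4 (λ x a y t → x :* (a :* (y :* t)) := x :* y :* (a :* t))
                                                        refl c₅ (K ^ A) ((2 * c) ^ T) (K ^ T) ⟩
            c₇ * (K ^ A * K ^ T)                   ≡⟨ cong (c₇ *_) (^-distribˡ-+-* K A T) ⟨
            c₇ * K ^ (A + T)                       ∎)
          where
          open ≤-Reasoning
          open +-*-Solver
          c₇ : ℕ
          c₇ = c₅ * (2 * c) ^ T
          2≤K : 2 ≤ K
          2≤K = ≤-trans (s≤s (s≤s z≤n)) (≤-trans (m≤n+m (2 + c₆) K₁) K₀≤K)
          instance
            K≢0 : NonZero K
            K≢0 = >-nonZero (<⇒≤ 2≤K)
          1≤T : 1 ≤ T
          1≤T = >-nonZero⁻¹ T {{m*n≢0 (d₁ * d₂) D {{m*n≢0 d₁ d₂}}}}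
          Z≤2cK : Z ≤ 2 * c * K
          Z≤2cK = ≤-trans Z≤ (≤-trans (+-monoˡ-≤ (c * K) 4k≤cK)
            (≤-reflexive (solve 2 (λ c K → c :* K :+ c :* K := con 2 :* c :* K) refl c K)))

-- The cuts of n/(log₂ n)^β at powers of two

module _ where

  import Data.Nat.Properties as Natₚ
  open import Data.Integer.Base as Int using (ℤ; +_; -[1+_])
  import Data.Integer.Properties as Intₚ
  open import Data.Rational.Base using (*<*; *≤*; _<_; _≤_; _*_; _+_)
  import Data.Rational.Unnormalised.Properties as ℚᵘₚ
  open RationalLemmas

  -- The embedding of the natural numbers in the rationals

  fromℕ-+ : ∀ m n → fromℕ (m Nat.+ n) ≡ fromℕ m + fromℕ n
  fromℕ-+ zero    n = sym (Ratₚ.+-identityˡ (fromℕ n))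
  fromℕ-+ (suc m) n = begin
    fromℕ (suc (m Nat.+ n))      ≡⟨ fromℕ-suc (m Nat.+ n) ⟩
    1ℚ + fromℕ (m Nat.+ n)       ≡⟨ cong (λ x → 1ℚ + x) (fromℕ-+ m n) ⟩
    1ℚ + (fromℕ m + fromℕ n)     ≡⟨ Ratₚ.+-assoc 1ℚ (fromℕ m) (fromℕ n) ⟨
    (1ℚ + fromℕ m) + fromℕ n     ≡⟨ cong (_+ fromℕ n) (fromℕ-suc m) ⟨
    fromℕ (suc m) + fromℕ n      ∎
    where open ≡-Reasoning

  fromℕ-* : ∀ m n → fromℕ (m Nat.* n) ≡ fromℕ m * fromℕ n
  fromℕ-* zero    n = sym (Ratₚ.*-zeroˡ (fromℕ n))
  fromℕ-* (suc m) n = begin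
    fromℕ (n Nat.+ m Nat.* n)            ≡⟨ fromℕ-+ n (m Nat.* n) ⟩
    fromℕ n + fromℕ (m Nat.* n)          ≡⟨ cong₂ _+_ (sym (Ratₚ.*-identityˡ (fromℕ n))) (fromℕ-* m n) ⟩
    1ℚ * fromℕ n + fromℕ m * fromℕ n     ≡⟨ Ratₚ.*-distribʳ-+ (fromℕ n) 1ℚ (fromℕ m) ⟨
    (1ℚ + fromℕ m) * fromℕ n             ≡⟨ cong (_* fromℕ n) (fromℕ-suc m) ⟨
    fromℕ (suc m) * fromℕ n              ∎
    where open ≡-Reasoning

  fromℕ-^ : ∀ m n → fromℕ (m Nat.^ n) ≡ fromℕ m ^ℚ n
  fromℕ-^ m zero    = refl
  fromℕ-^ m (suc n) = trans (fromℕ-* m (m Nat.^ n)) (cong (fromℕ m *_) (fromℕ-^ m n))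

  fromℕ-mono-≤ : ∀ {m n} → m Nat.≤ n → fromℕ m ≤ fromℕ n
  fromℕ-mono-≤ m≤n = *≤* (Intₚ.*-monoʳ-≤-nonNeg (+ 1) (Int.+≤+ m≤n))

  fromℕ-cancel-≤ : ∀ {m n} → fromℕ m ≤ fromℕ n → m Nat.≤ n
  fromℕ-cancel-≤ {m} {n} (*≤* le) = Intₚ.drop‿+≤+ (subst₂ Int._≤_ (Intₚ.*-identityʳ (+ m)) (Intₚ.*-identityʳ (+ n)) le)

  fromℕ-mono-< : ∀ {m n} → m Nat.< n → fromℕ m < fromℕ n
  fromℕ-mono-< m<n = *<* (Intₚ.*-monoʳ-<-pos (+ 1) (Int.+<+ m<n))

  fromℕ-nonNeg : ∀ n → 0ℚ ≤ fromℕ n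
  fromℕ-nonNeg n = fromℕ-mono-≤ Nat.z≤n

  ^-nonNeg : ∀ {a} n → 0ℚ ≤ a → 0ℚ ≤ a ^ℚ n
  ^-nonNeg     zero    0≤a = Ratₚ.<⇒≤ 0<1
  ^-nonNeg {a} (suc n) 0≤a = subst (_≤ a ^ℚ suc n) (Ratₚ.*-zeroʳ a) (*-monoˡ 0≤a (^-nonNeg n 0≤a))

  ^-mono-nonNeg : ∀ {a b} n → 0ℚ ≤ a → a ≤ b → a ^ℚ n ≤ b ^ℚ n
  ^-mono-nonNeg zero    0≤a a≤b = Ratₚ.≤-refl
  ^-mono-nonNeg (suc n) 0≤a a≤b =
    *-mono (^-nonNeg n 0≤a) (Ratₚ.≤-trans 0≤a a≤b) a≤b (^-mono-nonNeg n 0≤a a≤b)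

  *-cancelˡ-≤ℚ : ∀ {a b c} → 0ℚ < a → a * b ≤ a * c → b ≤ c
  *-cancelˡ-≤ℚ {a} 0<a = Ratₚ.*-cancelˡ-≤-pos a {{Rat.positive 0<a}}

  module _ {k : ℕ} .{{_ : NonTrivial (2 Nat.^ k)}} where

    log₂-2^-upper⁻¹ : ∀ {q} → ℝ.upper (proj₁ (log₂ (2 Nat.^ k))) q → fromℕ k < q
    log₂-2^-upper⁻¹ (mkℚ (+ a) d-1 _ , r<q , _ , le) = Ratₚ.≤-<-trans
      (*≤* (subst₂ Int._≤_ (Intₚ.pos-* k (suc d-1)) (sym (Intₚ.*-identityʳ (+ a)))
        (Int.+≤+ (2^-cancel-≤ (subst (Nat._≤ 2 Nat.^ a) (Natₚ.^-*-assoc 2 k (suc d-1)) le))))) r<q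
    log₂-2^-upper⁻¹ (mkℚ -[1+ _ ] _ _ , _ , *≤* () , _)

    log₂-2^-upper : ∀ {q} → fromℕ k < q → ℝ.upper (proj₁ (log₂ (2 Nat.^ k))) q
    log₂-2^-upper k<q = fromℕ k , k<q , fromℕ-nonNeg k , Natₚ.≤-reflexive (Natₚ.^-identityʳ _)

    log₂-2^-lower : ∀ {q} → q < fromℕ k → ℝ.lower (proj₁ (log₂ (2 Nat.^ k))) q
    log₂-2^-lower q<k = fromℕ k , q<k , fromℕ-nonNeg k , Natₚ.≤-reflexive (sym (Natₚ.^-identityʳ _))

    -- The witnesses of the nested cuts chain together: `k < s′`, `s′ ^ b ≤ r′ ^ d` and
    -- `n * r′ ≤ 2 ^ k`.
    n/log₂^-lower⁻¹ : ∀ b d-1 .{c : Coprime b (suc d-1)} {q} n → ℝ.lower (n/log₂^ (mkℚ (+ b) d-1 c) (2 Nat.^ k)) q → fromℕ n ≤ q →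
                      n Nat.^ suc d-1 Nat.* k Nat.^ b Nat.≤ (2 Nat.^ k) Nat.^ suc d-1
    n/log₂^-lower⁻¹ b d-1 {q = q} n (r , s , q<r , (r′ , s′ , r′<s , 0<r′ , log<s′ , s′^b≤r′^d) , rs≤2^k) n≤q =
      fromℕ-cancel-≤ (begin
        fromℕ (n Nat.^ d Nat.* k Nat.^ b)     ≡⟨ fromℕ-* (n Nat.^ d) (k Nat.^ b) ⟩
        fromℕ (n Nat.^ d) * fromℕ (k Nat.^ b) ≡⟨ cong₂ _*_ (fromℕ-^ n d) (fromℕ-^ k b) ⟩
        fromℕ n ^ℚ d * fromℕ k ^ℚ b           ≤⟨ *-monoˡ (^-nonNeg d (fromℕ-nonNeg n)) (Ratₚ.≤-trans (^-mono-nonNeg b (fromℕ-nonNeg k) (Ratₚ.<⇒≤ k<s′)) s′^b≤r′^d) ⟩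
        fromℕ n ^ℚ d * r′ ^ℚ d                ≡⟨ *-^ (fromℕ n) r′ d ⟨
        (fromℕ n * r′) ^ℚ d                   ≤⟨ ^-mono-nonNeg d 0≤nr′ nr′≤2^k ⟩
        fromℕ (2 Nat.^ k) ^ℚ d                ≡⟨ fromℕ-^ (2 Nat.^ k) d ⟨
        fromℕ ((2 Nat.^ k) Nat.^ d)           ∎)
      where
      open Ratₚ.≤-Reasoning
      d = suc d-1
      k<s′ : fromℕ k < s′
      k<s′ = log₂-2^-upper⁻¹ log<s′
      nr′≤2^k : fromℕ n * r′ ≤ fromℕ (2 Nat.^ k)
      nr′≤2^k = Ratₚ.≤-trans (*-mono (Ratₚ.<⇒≤ 0<r′) (Ratₚ.≤-trans (fromℕ-nonNeg n) n≤r)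
        n≤r Ratₚ.≤-refl) (Ratₚ.≤-trans (*-monoˡ (Ratₚ.≤-trans (fromℕ-nonNeg n) n≤r) (Ratₚ.<⇒≤ r′<s)) rs≤2^k)
        where
        n≤r = Ratₚ.≤-trans n≤q (Ratₚ.<⇒≤ q<r)
      0≤nr′ : 0ℚ ≤ fromℕ n * r′
      0≤nr′ = subst (_≤ fromℕ n * r′) (Ratₚ.*-zeroˡ r′) (*-monoʳ (Ratₚ.<⇒≤ 0<r′) (fromℕ-nonNeg n))

  positivePart negativePart : ℤ → ℕ
  positivePart (+ n)    = n
  positivePart -[1+ n ] = 0
  negativePart (+ n)    = 0
  negativePart -[1+ n ] = suc n

  module _ {k : ℕ} .{{_ : NonTrivial (2 Nat.^ suc k)}} .{{_ : NonZero k}} (n : ℕ) where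

    private

      -- The factor 4 leaves room for the strict inequalities in the definitions of the cuts.
      W : ℕ
      W = 4 Nat.* suc n

      0<W : 0ℚ < fromℕ W
      0<W = fromℕ-pos W

      u-spec : ∃[ u ] (0ℚ < u × fromℕ W * u ≡ fromℕ (2 Nat.^ suc k))
      u-spec = divide⁺ 0<W (fromℕ-mono-< (Natₚ.m^n>0 2 (suc k)))

      u : ℚ
      u = proj₁ u-spec

      0<u : 0ℚ < u
      0<u = proj₁ (proj₂ u-spec)

      1+n*4u≡2^ : fromℕ (suc n) * (fromℕ 4 * u) ≡ fromℕ (2 Nat.^ suc k)
      1+n*4u≡2^ = begin
        fromℕ (suc n) * (fromℕ 4 * u)  ≡⟨ Ratₚ.*-assoc (fromℕ (suc n)) (fromℕ 4) u ⟨
        fromℕ (suc n) * fromℕ 4 * u    ≡⟨ cong (_* u) (fromℕ-* (suc n) 4) ⟨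
        fromℕ (suc n Nat.* 4) * u      ≡⟨ cong (λ x → fromℕ x * u) (Natₚ.*-comm (suc n) 4) ⟩
        fromℕ W * u                    ≡⟨ proj₂ (proj₂ u-spec) ⟩
        fromℕ (2 Nat.^ suc k)          ∎
        where open ≡-Reasoning

      <-*ˡ : ∀ {a b} → 0ℚ < b → 1ℚ < a → b < a * b
      <-*ˡ {a} {b} 0<b 1<a = subst (_< a * b) (Ratₚ.*-identityˡ b) (*-mono-<ʳ 0<b 1<a)

      n<1+n : fromℕ n < fromℕ (suc n)
      n<1+n = fromℕ-mono-< (Natₚ.n<1+n n)

      scale : ∀ {x y d} → x Nat.* W Nat.^ d Nat.≤ (2 Nat.^ suc k) Nat.^ d Nat.* y →
              fromℕ x ≤ u ^ℚ d * fromℕ y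
      scale {x} {y} {d} le = *-cancelˡ-≤ℚ (^-pos d 0<W) (begin
        fromℕ W ^ℚ d * fromℕ x                       ≡⟨ Ratₚ.*-comm (fromℕ W ^ℚ d) (fromℕ x) ⟩
        fromℕ x * fromℕ W ^ℚ d                       ≡⟨ cong (fromℕ x *_) (fromℕ-^ W d) ⟨
        fromℕ x * fromℕ (W Nat.^ d)                  ≡⟨ fromℕ-* x (W Nat.^ d) ⟨
        fromℕ (x Nat.* W Nat.^ d)                    ≤⟨ fromℕ-mono-≤ le ⟩
        fromℕ ((2 Nat.^ suc k) Nat.^ d Nat.* y)      ≡⟨ fromℕ-* ((2 Nat.^ suc k) Nat.^ d) y ⟩
        fromℕ ((2 Nat.^ suc k) Nat.^ d) * fromℕ y    ≡⟨ cong (_* fromℕ y) (fromℕ-^ (2 Nat.^ suc k) d) ⟩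
        fromℕ (2 Nat.^ suc k) ^ℚ d * fromℕ y         ≡⟨ cong (λ z → z ^ℚ d * fromℕ y) (proj₂ (proj₂ u-spec)) ⟨
        (fromℕ W * u) ^ℚ d * fromℕ y                 ≡⟨ cong (_* fromℕ y) (*-^ (fromℕ W) u d) ⟩
        fromℕ W ^ℚ d * u ^ℚ d * fromℕ y              ≡⟨ Ratₚ.*-assoc (fromℕ W ^ℚ d) (u ^ℚ d) (fromℕ y) ⟩
        fromℕ W ^ℚ d * (u ^ℚ d * fromℕ y)            ∎)
        where open Ratₚ.≤-Reasoning

    -- The logarithm is `suc k`, and the cuts need rationals strictly beyond it. Its two integer
    -- neighbours serve: `suc (suc k)` above for a positive power, `k` below for a negative one.
    n/log₂^-lower : ∀ α → suc (suc k) Nat.^ positivePart (↥ α) Nat.* W Nat.^ ↧ₙ α Nat.≤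
                          (2 Nat.^ suc k) Nat.^ ↧ₙ α Nat.* k Nat.^ negativePart (↥ α) →
                    ℝ.lower (n/log₂^ α (2 Nat.^ suc k)) (fromℕ n)
    n/log₂^-lower (mkℚ (+ a) d-1 _) le =
      fromℕ (suc n) , fromℕ 4 * u , n<1+n ,
      (u , fromℕ (suc (suc k)) , <-*ˡ 0<u (fromℕ-mono-< (Nat.s≤s (Nat.s≤s Nat.z≤n))) , 0<u ,
        log₂-2^-upper (fromℕ-mono-< (Natₚ.n<1+n (suc k))) ,
        subst₂ _≤_ (fromℕ-^ (suc (suc k)) a) (Ratₚ.*-identityʳ (u ^ℚ suc d-1)) (scale {d = suc d-1} le)) ,
      Ratₚ.≤-reflexive 1+n*4u≡2^
    -- A negative power is the reciprocal of a root, so one more cut intervenes: `u < 2u < 4u`, with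
    -- `t = 1/(2u)` strictly below `r = 1/u`.
    n/log₂^-lower (mkℚ -[1+ a ] d-1 _) le =
      fromℕ (suc n) , fromℕ 4 * u , n<1+n ,
      (fromℕ 2 * u , t , *-mono-<ʳ 0<u (fromℕ-mono-< (Nat.s≤s (Nat.s≤s (Nat.s≤s Nat.z≤n)))) , 0<t ,
        (r , fromℕ k , t<r , 0<r , fromℕ-pos k , log₂-2^-lower (fromℕ-mono-< (Natₚ.n<1+n k)) ,
          *-cancelˡ-≤ℚ (^-pos d 0<u) u^d*r^d≤) ,
        Ratₚ.≤-reflexive (sym 2u*t≡1)) ,
      Ratₚ.≤-reflexive 1+n*4u≡2^
      where
      d = suc d-1
      0<2u : 0ℚ < fromℕ 2 * u
      0<2u = *-pos {fromℕ 2} (fromℕ-pos 2) 0<u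
      t-spec = divide⁺ {b = 1ℚ} 0<2u 0<1
      r-spec = divide⁺ {b = 1ℚ} 0<u 0<1
      t = proj₁ t-spec
      r = proj₁ r-spec
      0<t = proj₁ (proj₂ t-spec)
      0<r = proj₁ (proj₂ r-spec)
      2u*t≡1 = proj₂ (proj₂ t-spec)
      u*r≡1 = proj₂ (proj₂ r-spec)
      t<r : t < r
      t<r = *-cancelˡ-< 0<u (subst (u * t <_) (trans 2u*t≡1 (sym u*r≡1))
        (*-mono-<ʳ 0<t (<-*ˡ 0<u (fromℕ-mono-< (Nat.s≤s (Nat.s≤s Nat.z≤n))))))
      u^d*r^d≤ : u ^ℚ d * r ^ℚ d ≤ u ^ℚ d * fromℕ k ^ℚ suc a
      u^d*r^d≤ = begin
        u ^ℚ d * r ^ℚ d                   ≡⟨ *-^ u r d ⟨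
        (u * r) ^ℚ d                      ≡⟨ cong (_^ℚ d) u*r≡1 ⟩
        1ℚ ^ℚ d                           ≡⟨ 1^n d ⟩
        1ℚ                                ≤⟨ scale {d = d} le ⟩
        u ^ℚ d * fromℕ (k Nat.^ suc a)    ≡⟨ cong (u ^ℚ d *_) (fromℕ-^ k (suc a)) ⟩
        u ^ℚ d * fromℕ k ^ℚ suc a         ∎
        where open Ratₚ.≤-Reasoning

  -- α + 1 < β over the common denominator, free of subtraction.
  cross-multiply : ∀ α b d-1 .{c : Coprime b (suc d-1)} → α + 1ℚ < mkℚ (+ b) d-1 c →
                   positivePart (↥ α) Nat.* suc d-1 Nat.+ ↧ₙ α Nat.* suc d-1 Nat.<
                   b Nat.* ↧ₙ α Nat.+ negativePart (↥ α) Nat.* suc d-1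
  cross-multiply α@record{} b d-1 α+1<β = go (↥ α)
      (ℚᵘₚ.drop-*<* (ℚᵘₚ.<-respˡ-≃ (Ratₚ.toℚᵘ-homo-+ α 1ℚ) (Ratₚ.toℚᵘ-mono-< α+1<β)))
    where
    open ≡-Reasoning
    e = ↧ₙ α
    d = suc d-1
    clear : ∀ z → (z Int.* + 1 Int.+ + 1 Int.* + e) Int.* + d ≡ z Int.* + d Int.+ + (e Nat.* d)
    clear z = begin
      (z Int.* + 1 Int.+ + 1 Int.* + e) Int.* + d  ≡⟨ cong (Int._* + d) (cong₂ Int._+_ (Intₚ.*-identityʳ z) (Intₚ.*-identityˡ (+ e))) ⟩
      (z Int.+ + e) Int.* + d                      ≡⟨ Intₚ.*-distribʳ-+ (+ d) z (+ e) ⟩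
      z Int.* + d Int.+ + e Int.* + d              ≡⟨ cong (λ x → z Int.* + d Int.+ x) (Intₚ.pos-* e d) ⟨
      z Int.* + d Int.+ + (e Nat.* d)              ∎
    right : + b Int.* + (e Nat.* 1) ≡ + (b Nat.* e)
    right = trans (cong (λ x → + b Int.* + x) (Natₚ.*-identityʳ e)) (sym (Intₚ.pos-* b e))
    go : ∀ z → (z Int.* + 1 Int.+ + 1 Int.* + e) Int.* + d Int.< + b Int.* + (e Nat.* 1) →
         positivePart z Nat.* d Nat.+ e Nat.* d Nat.< b Nat.* e Nat.+ negativePart z Nat.* d
    go z lt with subst₂ Int._<_ (clear z) right lt
    go (+ a)    _ | lt = subst (a Nat.* d Nat.+ e Nat.* d Nat.<_) (sym (Natₚ.+-identityʳ _))
      (Intₚ.drop‿+<+ (subst (λ x → x Int.+ + (e Nat.* d) Int.< + (b Nat.* e)) (sym (Intₚ.pos-* a d)) lt))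
    go -[1+ a ] _ | lt = Intₚ.drop‿+<+ (subst₂ Int._<_ left refl (Intₚ.+-monoˡ-< (+ (suc a Nat.* d)) lt))
      where
      left : (-[1+ a ] Int.* + d Int.+ + (e Nat.* d)) Int.+ + (suc a Nat.* d) ≡ + (e Nat.* d)
      left = begin
        (-[1+ a ] Int.* + d Int.+ + (e Nat.* d)) Int.+ + (suc a Nat.* d)
          ≡⟨ cong (Int._+ + (suc a Nat.* d)) (Intₚ.+-comm (-[1+ a ] Int.* + d) (+ (e Nat.* d))) ⟩
        (+ (e Nat.* d) Int.+ -[1+ a ] Int.* + d) Int.+ + (suc a Nat.* d)
          ≡⟨ Intₚ.+-assoc (+ (e Nat.* d)) (-[1+ a ] Int.* + d) (+ (suc a Nat.* d)) ⟩
        + (e Nat.* d) Int.+ (-[1+ a ] Int.* + d Int.+ + (suc a Nat.* d))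
          ≡⟨ cong (λ x → + (e Nat.* d) Int.+ x) (Intₚ.+-inverseˡ (+ (suc a Nat.* d))) ⟩
        + (e Nat.* d) Int.+ + 0
          ≡⟨ Intₚ.+-identityʳ _ ⟩
        + (e Nat.* d) ∎

-- The reduction

module _ where

  open import Data.Integer.Base using (+_)
  open import Data.Nat.Base
  open import Data.Nat.Properties

  module Levels (D : ℕ) .{{_ : NonZero D}} where

    abstract

      level-spec : ∀ κ → ∃[ t ] (0 ≤ t × 2 ^ (D * t) ≤ suc κ × suc κ < 2 ^ (D * suc t))
      level-spec κ = crossing (λ t → 2 ^ (D * t)) 0 (suc κ)
        (≤-trans (≤-reflexive (cong (2 ^_) (*-zeroʳ D))) (s≤s z≤n))
        (<-≤-trans (n<2^n (suc κ)) (^-monoʳ-≤ 2 (m≤n*m (suc κ) D)))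

    -- The level of stream suc κ; stream 0 is not needed.
    level : ℕ → ℕ
    level κ = proj₁ (level-spec κ)

    2^D*level≤ : ∀ κ → 2 ^ (D * level κ) ≤ suc κ
    2^D*level≤ κ = proj₁ (proj₂ (proj₂ (level-spec κ)))

    <2^D*suc-level : ∀ κ → suc κ < 2 ^ (D * suc (level κ))
    <2^D*suc-level κ = proj₂ (proj₂ (proj₂ (level-spec κ)))

    level≤ : ∀ κ → level κ ≤ suc κ
    level≤ κ = ≤-trans (m≤n*m (level κ) D) (≤-trans (<⇒≤ (n<2^n (D * level κ))) (2^D*level≤ κ))

    period : ℕ → ℕ
    period κ = suc D * suc (level κ)

    windowLength : ℕ → ℕ
    windowLength κ = 2 * (2 ^ period κ * 2 ^ suc κ)

    windowLength≡ : ∀ κ → windowLength κ ≡ 2 ^ (period κ + (2 + κ))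
    windowLength≡ κ = begin
      2 * (2 ^ period κ * 2 ^ suc κ)    ≡⟨ cong (2 *_) (^-distribˡ-+-* 2 (period κ) (suc κ)) ⟨
      2 ^ suc (period κ + suc κ)        ≡⟨ cong (2 ^_) (+-suc (period κ) (suc κ)) ⟨
      2 ^ (period κ + (2 + κ))          ∎
      where open ≡-Reasoning

    κ<windowLength : ∀ κ → κ < windowLength κ
    κ<windowLength κ = subst (κ <_) (sym (windowLength≡ κ)) (<-≤-trans (n<2^n κ)
      (^-monoʳ-≤ 2 (≤-trans (m≤n+m κ 2) (m≤n+m (2 + κ) (period κ)))))

    -- `gap` absorbs any overhead linear in `K`, so the crude bound `level κ ≤ suc κ` is good enough
    -- here. The outer 4 is the slack that `n/log₂^-lower` asks for.
    description≤ : ∀ c κ k → 4 * suc (c + 4 * suc (suc κ + period κ) + k) ≤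
                   4 * k + 4 * (suc c + 4 * (2 + 2 * suc D)) * suc κ
    description≤ c κ k = begin
      4 * suc (c + 4 * suc (suc κ + period κ) + k)
        ≡⟨ solve 4 (λ c κ p k → con 4 :* (con 1 :+ (c :+ con 4 :* (con 1 :+ (con 1 :+ κ :+ p)) :+ k)) :=
                     con 4 :* k :+ con 4 :* (con 1 :+ c :+ con 4 :* (con 2 :+ κ :+ p))) refl c κ (period κ) k ⟩
      4 * k + 4 * (suc c + 4 * (2 + κ + period κ))
        ≤⟨ +-monoʳ-≤ (4 * k) (*-monoʳ-≤ 4 (+-mono-≤ (m≤m*n (suc c) (suc κ)) (*-monoʳ-≤ 4 (+-mono-≤ 2+κ≤ period≤)))) ⟩
      4 * k + 4 * (suc c * suc κ + 4 * (2 * suc κ + suc D * (2 * suc κ)))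
        ≡⟨ solve 4 (λ c κ d k → con 4 :* k :+ con 4 :* (c :* κ :+ con 4 :* (con 2 :* κ :+ d :* (con 2 :* κ))) :=
                     con 4 :* k :+ con 4 :* (c :+ con 4 :* (con 2 :+ con 2 :* d)) :* κ) refl (suc c) (suc κ) (suc D) k ⟩
      4 * k + 4 * (suc c + 4 * (2 + 2 * suc D)) * suc κ ∎
      where
      open ≤-Reasoning
      open +-*-Solver
      2+κ≤ : 2 + κ ≤ 2 * suc κ
      2+κ≤ = 1+n≤2*n (s≤s z≤n)
      period≤ : period κ ≤ suc D * (2 * suc κ)
      period≤ = *-monoʳ-≤ (suc D) (≤-trans (s≤s (level≤ κ)) 2+κ≤)

  module _ (U : Machine) (U-universal : Universal U) (α : ℚ) (r d₂-1 : ℕ) .{coprime : Coprime r (suc d₂-1)}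
           (α+1<β : α Rat.+ 1ℚ Rat.< mkℚ (+ r) d₂-1 coprime)
           (a b : ℕ) .{{_ : NonTrivial a}} .{{_ : NonTrivial b}} where

    private
      β : ℚ
      β = mkℚ (+ r) d₂-1 coprime

    open Growth (positivePart (↥ α)) (negativePart (↥ α)) (↧ₙ α) (suc d₂-1) r
      (cross-multiply α r d₂-1 {coprime} α+1<β) using (D; gap)
    open Levels D

    module _ (f-mono : NondecreasingFrom a (n/log₂^ α)) (g-mono : NondecreasingFrom b (n/log₂^ β))
             (X : ℕ → Bool) (complex : COMPLEX U (setBelow a (n/log₂^ α)) X) where

      private
        cM = proj₁ (substring-computes-prefix U U-universal)
        cX = proj₁ complex

        nonTrivial-2^suc : ∀ k → NonTrivial (2 ^ suc k)
        nonTrivial-2^suc k = n>1⇒nonTrivial (*-monoʳ-≤ 2 (m^n>0 2 k))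

        gap-spec = gap (4 * (suc (cM + cX) + 4 * (2 + 2 * suc D)))

        -- Both `2 ^ suc κ` and `windowLength κ` exceed `κ`, so adding `a + b` puts them past the
        -- two cutoffs.
        κ₀ : ℕ
        κ₀ = proj₁ gap-spec + (a + b)

        K₀≤ : ∀ {κ} → κ₀ ≤ κ → proj₁ gap-spec ≤ κ
        K₀≤ = ≤-trans (m≤m+n (proj₁ gap-spec) (a + b))
        a≤ : ∀ {κ} → κ₀ ≤ κ → a ≤ κ
        a≤ = ≤-trans (≤-trans (m≤m+n a b) (m≤n+m (a + b) (proj₁ gap-spec)))
        b≤ : ∀ {κ} → κ₀ ≤ κ → b ≤ κ
        b≤ = ≤-trans (≤-trans (m≤n+m b a) (m≤n+m (a + b) (proj₁ gap-spec)))

        -- Monotonicity moves the bound from length `n` up to the window length, a power of two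
        -- whose logarithm is known exactly.
        setBelow-lower : ∀ κ n k {q} → κ₀ ≤ κ → n ≤ windowLength κ → fromℕ k Rat.≤ q →
                         ℝ.lower (setBelow b (n/log₂^ β) n) q →
                         k ^ suc d₂-1 * (period κ + (2 + κ)) ^ r ≤ (2 ^ (period κ + (2 + κ))) ^ suc d₂-1
        setBelow-lower κ n k {q} κ₀≤κ n≤ k≤q q∈ = n/log₂^-lower⁻¹ r d₂-1 {coprime} k
          (g-mono (b ⊔ n) (2 ^ E) {{n>1⇒nonTrivial (≤-trans (nonTrivial⇒n>1 b) (m≤m⊔n b n))}} (m≤m⊔n b n)
            (subst (b ⊔ n ≤_) (windowLength≡ κ) (⊔-lub (≤-trans (b≤ κ₀≤κ) (<⇒≤ (κ<windowLength κ))) n≤)) q q∈) k≤q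
          where
          E = period κ + (2 + κ)
          instance
            2^E-nonTrivial : NonTrivial (2 ^ E)
            2^E-nonTrivial = subst (λ e → NonTrivial (2 ^ e)) (sym (+-suc (period κ) (suc κ)))
              (nonTrivial-2^suc (period κ + suc κ))

        -- One more than `windowLength κ₀`. At that length the bound is at most the length itself,
        -- so `c` alone outweighs it on every shorter substring.
        c : ℕ
        c = suc (2 ^ (period κ₀ + (2 + κ₀)))

      short-substring : ∀ n k {q} → n ≤ windowLength κ₀ → ℝ.lower (setBelow b (n/log₂^ β) n) q →
                        ¬ (fromℕ (k + c) Rat.≤ q)
      short-substring n k n≤ q∈ k+c≤q = <⇒≱ (begin-strict
        (2 ^ E) ^ suc d₂-1                ≡⟨ *-identityʳ _ ⟨
        (2 ^ E) ^ suc d₂-1 * 1            <⟨ *-mono-<-≤ᵣ ⟩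
        (k + c) ^ suc d₂-1 * E ^ r        ∎)
        (setBelow-lower κ₀ n (k + c) ≤-refl n≤ k+c≤q q∈)
        where
        open ≤-Reasoning
        E = period κ₀ + (2 + κ₀)
        E≢0 : NonZero E
        E≢0 = >-nonZero (≤-trans (s≤s z≤n) (m≤n+m (2 + κ₀) (period κ₀)))
        *-mono-<-≤ᵣ : (2 ^ E) ^ suc d₂-1 * 1 < (k + c) ^ suc d₂-1 * E ^ r
        *-mono-<-≤ᵣ = <-≤-trans (*-monoˡ-< 1 (^-monoˡ-< (suc d₂-1) (m≤n+m c k)))
          (*-monoʳ-≤ ((k + c) ^ suc d₂-1) (m^n>0 E {{E≢0}} r))

      long-substring : ∀ s n k κ {q} → κ₀ ≤ κ → windowLength κ ≤ n → n ≤ windowLength (suc κ) →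
                       IsK U (substring (X ∘ index D) s n) k →
                       ℝ.lower (setBelow b (n/log₂^ β) n) q → ¬ (fromℕ k Rat.≤ q)
      long-substring s n k κ {q} κ₀≤κ ≤n n≤ ((π , refl , π↓) , _) q∈ k≤q =
        let θ , θ≤ , θ↓ = proj₂ (substring-computes-prefix U U-universal) D (level κ) (suc κ) X s n
                            (<2^D*suc-level κ) ≤n π π↓
        in IsK-exists U {X ↾ (2 ^ suc κ)} θ θ↓ λ (k′ , k′≤θ , isK) →
          Ratₚ.<-irrefl refl (Ratₚ.<-≤-trans (proj₂ complex (2 ^ suc κ) k′ isK (fromℕ Q) Q∈)
            (fromℕ-mono-≤ (≤-trans (+-monoˡ-≤ cX (≤-trans k′≤θ θ≤)) (≤-reflexive Q≡))))
        where
        K Q info : ℕ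
        K = suc κ
        info = 4 * suc (K + period κ)
        Q = cM + cX + info + k
        Q≡ : cM + info + k + cX ≡ Q
        Q≡ = solve 4 (λ m i k x → m :+ i :+ k :+ x := m :+ x :+ i :+ k) refl cM info k cX
          where open +-*-Solver
        instance
          κ≢0 : NonZero κ
          κ≢0 = >-nonZero (≤-trans (≤-trans (s≤s z≤n) (proj₁ (proj₂ gap-spec))) (K₀≤ κ₀≤κ))
          2^K-nonTrivial : NonTrivial (2 ^ suc κ)
          2^K-nonTrivial = nonTrivial-2^suc κ
        Q-small : suc K ^ positivePart (↥ α) * (4 * suc Q) ^ ↧ₙ α ≤ (2 ^ K) ^ ↧ₙ α * κ ^ negativePart (↥ α)
        -- The prefix is read from stream `K = suc κ`, but `n` is bounded only by the next window.
        -- So `E` and the level passed to `gap` are those of stream `suc K`.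
        Q-small = proj₂ (proj₂ gap-spec) K (≤-trans (K₀≤ κ₀≤κ) (n≤1+n κ)) k (level (suc κ)) (4 * suc Q)
          (2^D*level≤ (suc κ)) (description≤ (cM + cX) κ k)
          (setBelow-lower (suc κ) n k (≤-trans κ₀≤κ (n≤1+n κ)) n≤ k≤q q∈)
        Q∈ : ℝ.lower (setBelow a (n/log₂^ α) (2 ^ suc κ)) (fromℕ Q)
        Q∈ = f-mono (2 ^ suc κ) (a ⊔ 2 ^ suc κ)
          {{2^K-nonTrivial}} {{n>1⇒nonTrivial (≤-trans (nonTrivial⇒n>1 a) (m≤m⊔n a (2 ^ suc κ)))}}
          (≤-trans (a≤ κ₀≤κ) (≤-trans (n≤1+n κ) (<⇒≤ (n<2^n (suc κ)))))
          (m≤n⊔m a _) (fromℕ Q) (n/log₂^-lower Q α Q-small)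

      shiftComplex : SC U (setBelow b (n/log₂^ β)) (X ∘ index D)
      shiftComplex = c , λ { _ (s , n , refl) k isK q q∈ →
        -- Order on the rationals is decidable, so refuting the failure of the bound is enough; a
        -- least program for the prefix, available only under double negation, can then be used.
        decidable-stable (q Ratₚ.<? fromℕ (k + c)) λ q≮ → bounded s n k isK
          (subst (λ n → ℝ.lower (setBelow b (n/log₂^ β) n) q) (length-applyUpTo _ n) q∈) (Ratₚ.≮⇒≥ q≮) }
        where
        bounded : ∀ s n k {q} → IsK U (substring (X ∘ index D) s n) k →
                  ℝ.lower (setBelow b (n/log₂^ β) n) q → ¬ (fromℕ (k + c) Rat.≤ q)
        bounded s n k {q} isK q∈ le with n ≤? windowLength κ₀
        ... | yes n≤ = short-substring n k n≤ q∈ le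
        ... | no  n≰ with crossing windowLength κ₀ n (<⇒≤ (≰⇒> n≰))
                          (<-≤-trans (s≤s (m≤n+m n κ₀)) (κ<windowLength (κ₀ + n)))
        ...   | κ , κ₀≤κ , ≤n , n< = long-substring s n k κ κ₀≤κ ≤n (<⇒≤ n<) isK q∈
                (Ratₚ.≤-trans (fromℕ-mono-≤ (m≤m+n k c)) le)

open import Data.Integer.Base using (+_; -[1+_])
open import Data.Rational.Base using (_<_; _+_; *<*)

mainTheorem17 : ∀ (U : Machine) → Universal U →
    ∀ (α β : ℚ) → 0ℚ < α + 1ℚ → α + 1ℚ < β →
    ∀ a b → .{{_ : NonTrivial a}} → .{{_ : NonTrivial b}} →
    NondecreasingFrom a (n/log₂^ α) → NondecreasingFrom b (n/log₂^ β) →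
    binary (SC U (setBelow b (n/log₂^ β))) ≤ₛ binary (COMPLEX U (setBelow a (n/log₂^ α)))
mainTheorem17 U U-universal α (mkℚ (+ r) d₂-1 coprime) 0<α+1 α+1<β a b f-mono g-mono =
  compose (oracle 0F) (indexᶜ D .uncurried .program ∷ []) ,
  λ { Y (X , Y≡X , complex) →
    Y ∘ index D ,
    (λ n → compose↓ (indexᶜ D .uncurried .computes (n ∷ []) ∷ []) oracle↓) ,
    X ∘ index D , (λ n → Y≡X (index D n)) ,
    shiftComplex U U-universal α r d₂-1 α+1<β a b f-mono g-mono X complex }
  where
  -- Must agree definitionally with the `D` of `Growth`, for which `shiftComplex` is proved.
  D = suc (↧ₙ α Nat.* suc d₂-1)
mainTheorem17 U U-universal α (mkℚ -[1+ _ ] _ _) 0<α+1 α+1<β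
  with *<* () ← Ratₚ.<-trans 0<α+1 α+1<β
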